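{- Let $n>1$ be an integer and let $\mathcal L$ be the Hough ensemble generated from $n$ base functions $f_0,\dots,f_{n-1}$ on a square $n\times n$ image. Then $$\mu(\mathcal L)<\frac{4n^3}{\log_2 n}\left(1-\frac{1}{\log_2 n+1}+\sqrt{\frac 2n}\right).$$ Moreover, the corresponding computation chain has small depth: there is a computation chain $\mathfrak C$ computing $\mathcal L$ from the ensemble $\mathcal I=\{\{p\}\mid p\in\mathbb I\}$ of all single pixels, whose weight $\omega(\mathfrak C)$ is smaller than the right-hand side above, and whose depth is at most $\log_2 n\cdot(\log_2 n+1)$.
   Context: Image and Hough ensemble. $X=Y=\{0,1,\dots,n-1\}$, and the image is $\mathbb I=X\times Y$, whose elements are pixels. $\mathrm{mod}_n(m)\in\{0,\dots,n-1\}$ is the remainder of $m$ modulo $n$; $[t]=\lfloor t+\tfrac12\rfloor$ for real $t$. For $s\in\mathbb Z$, $(x,y)+s=(x,\mathrm{mod}_n(y+s))$, and $P+s=\{p+s\mid p\in P\}$ for $P\subseteq\mathbb I$. For $f\colon X\to Y$, $\hat f(x)=(x,f(x))$ and $\hat f(A)=\{\hat f(x)\mid x\in A\}$. For $e\in\{0,\dots,n-1\}$ the base function is $f_e\colon X\to Y$, $f_e(x)=\mathrm{mod}_n\left(\left[\frac{e}{n-1}x\right]\right)$. The Hough ensemble is $\mathcal L=\bigcup_{e=0}^{n-1}\{\hat f_e(X)+s\mid s\in Y\}$. Ensembles and complexity. An ensemble on a finite set $U$ is a non-empty collection of non-empty subsets (patterns) of $U$; $\operatorname{supp}\mathcal A=\bigcup_{A\in\mathcal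 A}A$. Ensemble $\mathcal A$ combines $\mathcal B$ (written $\mathcal A\vartriangleright\mathcal B$) if every $B\in\mathcal B$ is a disjoint union of some patterns of $\mathcal A$. In this case, for $B\in\mathcal B$ let $\omega_{\mathcal A}(B)=\min\{|\sigma| : \sigma\subseteq\mathcal A,\ \bigsqcup_{A\in\sigma}A=B\}-1$ and $d_{\mathcal A}(B)=\lceil\log_2(\omega_{\mathcal A}(B)+1)\rceil$; put $|\mathcal A\vartriangleright\mathcal B|=\sum_{B\in\mathcal B}\omega_{\mathcal A}(B)$ and $d_{\mathcal A}(\mathcal B)=\max_{B\in\mathcal B}d_{\mathcal A}(B)$. A computation chain computing $\mathcal A_m$ from $\mathcal A_0$ is a sequence $\mathfrak C=[\mathcal A_0\vartriangleright\mathcal A_1\vartriangleright\dots\vartriangleright\mathcal A_m]$; its weight is $\omega(\mathfrak C)=\sum_{i=0}^{m-1}|\mathcal A_i\vartriangleright\mathcal A_{i+1}|$ and its depth is $\sum_{i=0}^{m-1}d_{\mathcal A_i}(\mathcal A_{i+1})$. The complexity $\mu(\mathcal B)$ of an ensemble $\mathcal B$ is the minimal weight of a computation chain computing $\mathcal B$ from $\{\{u\}\mid u\in\operatorname{supp}\mathcal B\}$. -}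

module Defs where

open import Data.Fin.Base using (Fin; toℕ; fromℕ<; combine; remQuot) renaming (zero to fzero)
import Data.Fin.Properties as Fin
open import Data.Fin.Subset using (Subset; Nonempty; Empty; ⁅_⁆; ⋃; _∩_)
  renaming (_∈_ to _∈ₛ_; _⊆_ to _⊆ₛ_; ⊥ to ∅; ⊤ to full)
open import Data.Fin.Subset.Properties as Sub using (nonempty?)
  renaming (_∈?_ to _∈ₛ?_)
open import Data.Bool.Base using (true; false)
import Data.Bool.Properties as Bool
open import Data.Integer.Base as ℤ using (ℤ; +_)
import Data.Integer.DivMod as ℤ
import Data.Integer.Properties as ℤ
open import Data.Rational.Unnormalised.Base as ℚ using (ℚᵘ; mkℚᵘ; 0ℚᵘ; 1ℚᵘ)
import Data.Rational.Unnormalised.Properties as ℚ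
open import Data.Rational.Unnormalised.Solver using () renaming (module +-*-Solver to ℚ-Solver)
open import Data.Integer.Solver using () renaming (module +-*-Solver to ℤ-Solver)
open import Data.Nat.Solver using () renaming (module +-*-Solver to ℕ-Solver)
open import Data.List.Base
  using (List; []; _∷_; _++_; map; filter; length; allFin; cartesianProductWith; deduplicate; lookup)
open import Data.Nat.ListAction using (sum)
open import Data.List.Extrema.Nat using (min; max; min≤xs; argmin-sel)
open import Data.List.Membership.Propositional using (_∈_)
open import Data.List.Membership.Propositional.Properties
  using (∈-map⁺; ∈-map⁻; ∈-++⁺ˡ; ∈-++⁺ʳ; ∈-++⁻; ∈-filter⁺; ∈-filter⁻; ∈-allFin;
         ∈-cartesianProductWith⁺; ∈-cartesianProductWith⁻; ∈-deduplicate⁺; ∈-deduplicate⁻; ∈-lookup)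
import Data.List.Membership.Setoid.Properties as SetoidMembership
open import Data.List.Relation.Binary.Sublist.Propositional using (_⊆_; []; _∷_; _∷ʳ_; from∈)
import Data.List.Relation.Binary.Sublist.Propositional.Properties as Sublist
open import Data.List.Relation.Unary.All as All using (All; []; _∷_)
import Data.List.Relation.Unary.All.Properties as All
open import Data.List.Relation.Unary.AllPairs as AllPairs using (AllPairs; []; _∷_; allPairs?)
import Data.List.Relation.Unary.AllPairs.Properties as AllPairs
import Data.List.Relation.Unary.Any.Properties as Any
open import Data.List.Relation.Unary.Any as Any using (Any; here; there; index)
open import Data.List.Relation.Unary.Unique.Propositional using (Unique)
import Data.List.Relation.Unary.Unique.Propositional.Properties as Unique
import Data.List.Relation.Unary.Unique.DecPropositional.Properties as Unique
open import Data.Nat.Base as ℕ using (ℕ; zero; suc; _∸_; NonZero; NonTrivial; z≤n; s≤s)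
import Data.Nat.Properties as ℕ
open import Data.Nat.Induction using (<-rec)
open import Data.Nat.Logarithm
  using (⌈log₂_⌉; ⌊log₂_⌋; ⌊log₂⌊n/2⌋⌋≡⌊log₂n⌋∸1; ⌊log₂⌋-mono-≤; ⌊log₂[2^n]⌋≡n)
open import Data.Product.Base using (Σ-syntax; ∃-syntax; _×_; _,_; proj₁; proj₂)
open import Data.Sum.Base as Sum using (_⊎_; inj₁; inj₂)
import Data.Vec.Base as Vec
import Data.Vec.Properties as Vec
open import Function.Base using (_∘_; id)
open import Relation.Binary.PropositionalEquality
  using (_≡_; _≢_; refl; sym; trans; cong; cong₂; subst; subst₂)
open import Relation.Nullary using (¬_; Dec; yes; no; ¬?; contradiction)
open import Relation.Nullary.Decidable using (_×-dec_; map′)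

private
  variable
    N : ℕ

infix 4 _≟ₛ_

_≟ₛ_ : (P Q : Subset N) → Dec (P ≡ Q)
_≟ₛ_ = Vec.≡-dec Bool._≟_

Disjoint : Subset N → Subset N → Set
Disjoint P Q = Empty (P ∩ Q)

infix 4 _PartitionOf_

_PartitionOf_ : List (Subset N) → Subset N → Set
σ PartitionOf B = AllPairs Disjoint σ × ⋃ σ ≡ B

partitionOf? : (B : Subset N) (σ : List (Subset N)) → Dec (σ PartitionOf B)
partitionOf? B σ = allPairs? (λ P Q → ¬? (nonempty? (P ∩ Q))) σ ×-dec (⋃ σ ≟ₛ B)

elements : Subset N → List (Fin N)
elements P = filter (_∈ₛ? P) (allFin _)

image : ∀ {M} → (Fin M → Fin N) → Subset M → Subset N
image g P = ⋃ (map (⁅_⁆ ∘ g) (elements P))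

-- On a duplicate-free list the sublists are exactly the subsets.
sublists : ∀ {A : Set} → List A → List (List A)
sublists []       = [] ∷ []
sublists (x ∷ xs) = map (x ∷_) (sublists xs) ++ sublists xs

∈-sublists⁺ : ∀ {A : Set} {xs ys : List A} → xs ⊆ ys → xs ∈ sublists ys
∈-sublists⁺ []          = here refl
∈-sublists⁺ {ys = y ∷ ys} (y ∷ʳ p) = ∈-++⁺ʳ (map (y ∷_) (sublists ys)) (∈-sublists⁺ p)
∈-sublists⁺ (refl ∷ p)  = ∈-++⁺ˡ (∈-map⁺ (_ ∷_) (∈-sublists⁺ p))

∈-sublists⁻ : ∀ {A : Set} {xs : List A} ys → xs ∈ sublists ys → xs ⊆ ys
∈-sublists⁻ []       (here refl) = []
∈-sublists⁻ (y ∷ ys) xs∈ with ∈-++⁻ (map (y ∷_) (sublists ys)) xs∈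
... | inj₂ xs∈ʳ = y ∷ʳ ∈-sublists⁻ ys xs∈ʳ
... | inj₁ xs∈ˡ with ∈-map⁻ (y ∷_) xs∈ˡ
...   | zs , zs∈ , refl = refl ∷ ∈-sublists⁻ ys zs∈

-- A finite set of subsets of Fin N, listed without repetition; no quantity below
-- depends on the order of the list.
record Ensemble (N : ℕ) : Set where
  field
    patterns        : List (Subset N)
    unique          : Unique patterns
    nonempty        : patterns ≢ []
    patternNonempty : All Nonempty patterns

open Ensemble public

supp : Ensemble N → Subset N
supp 𝒜 = ⋃ (patterns 𝒜)

infix 4 _▷_

_▷_ : Ensemble N → Ensemble N → Set
𝒜 ▷ ℬ = All (λ B → ∃[ σ ] σ ⊆ patterns 𝒜 × σ PartitionOf B) (patterns ℬ)

decompositions : Ensemble N → Subset N → List (List (Subset N))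
decompositions 𝒜 B = filter (partitionOf? B) (sublists (patterns 𝒜))

-- The default value of `min` matters only when B has no decomposition:
-- otherwise it is at least the length of any sublist of `patterns 𝒜`.
leastSize : Ensemble N → Subset N → ℕ
leastSize 𝒜 B = min (length (patterns 𝒜)) (map length (decompositions 𝒜 B))

ω : Ensemble N → Subset N → ℕ
ω 𝒜 B = leastSize 𝒜 B ∸ 1

d : Ensemble N → Subset N → ℕ
d 𝒜 B = ⌈log₂ (ω 𝒜 B ℕ.+ 1) ⌉

∣_▷_∣ : Ensemble N → Ensemble N → ℕ
∣ 𝒜 ▷ ℬ ∣ = sum (map (ω 𝒜) (patterns ℬ))

stepDepth : Ensemble N → Ensemble N → ℕ
stepDepth 𝒜 ℬ = max 0 (map (d 𝒜) (patterns ℬ))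

-- `Chain 𝒜 ℬ` is the type of computation chains computing ℬ from 𝒜.  Since
-- 𝒜 ▷ ℬ costs nothing when ℬ merely relists the patterns of 𝒜, asking for the
-- end points on the nose loses no generality.
data Chain {N} : Ensemble N → Ensemble N → Set where
  []  : ∀ {𝒜} → Chain 𝒜 𝒜
  _∷_ : ∀ {𝒜 ℬ 𝒞} → 𝒜 ▷ ℬ → Chain ℬ 𝒞 → Chain 𝒜 𝒞

weight : ∀ {𝒜 ℬ : Ensemble N} → Chain 𝒜 ℬ → ℕ
weight []                    = 0
weight (_∷_ {𝒜} {ℬ} _ ℭ) = ∣ 𝒜 ▷ ℬ ∣ ℕ.+ weight ℭ

depth : ∀ {𝒜 ℬ : Ensemble N} → Chain 𝒜 ℬ → ℕ
depth []                    = 0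
depth (_∷_ {𝒜} {ℬ} _ ℭ) = stepDepth 𝒜 ℬ ℕ.+ depth ℭ

leastSize-≤ : ∀ (𝒜 : Ensemble N) {B σ} → σ ⊆ patterns 𝒜 → σ PartitionOf B →
              leastSize 𝒜 B ℕ.≤ length σ
leastSize-≤ 𝒜 {B} σ⊆𝒜 σ-part =
  All.lookup (min≤xs (length (patterns 𝒜)) (map length (decompositions 𝒜 B)))
             (∈-map⁺ length (∈-filter⁺ (partitionOf? B) (∈-sublists⁺ σ⊆𝒜) σ-part))

leastSize-attained : ∀ (𝒜 : Ensemble N) {B} → (∃[ σ ] σ ⊆ patterns 𝒜 × σ PartitionOf B) →
                     ∃[ σ ] σ ⊆ patterns 𝒜 × σ PartitionOf B × length σ ≡ leastSize 𝒜 B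
leastSize-attained 𝒜 {B} (σ , σ⊆𝒜 , σ-part)
  with argmin-sel id (length (patterns 𝒜)) (map length (decompositions 𝒜 B))
... | inj₁ eq = σ , σ⊆𝒜 , σ-part ,
      ℕ.≤-antisym (subst (length σ ℕ.≤_) (sym eq) (Sublist.length-mono-≤ σ⊆𝒜)) (leastSize-≤ 𝒜 σ⊆𝒜 σ-part)
... | inj₂ least∈ with ∈-map⁻ length least∈
...   | τ , τ∈ , eq with ∈-filter⁻ (partitionOf? B) {xs = sublists (patterns 𝒜)} τ∈
...     | τ∈sub , τ-part = τ , ∈-sublists⁻ _ τ∈sub , τ-part , sym eq

∈-⋃⁺ : ∀ {x : Fin N} {P σ} → P ∈ σ → x ∈ₛ P → x ∈ₛ ⋃ σ
∈-⋃⁺ {P = P} {σ = _ ∷ σ} (here refl) x∈P = Sub.x∈p∪q⁺ (inj₁ x∈P)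
∈-⋃⁺ {σ = Q ∷ _} (there P∈σ) x∈P = Sub.x∈p∪q⁺ (inj₂ (∈-⋃⁺ P∈σ x∈P))

∈-⋃⁻ : ∀ {x : Fin N} σ → x ∈ₛ ⋃ σ → ∃[ P ] P ∈ σ × x ∈ₛ P
∈-⋃⁻ []      x∈ = contradiction x∈ Sub.∉⊥
∈-⋃⁻ (P ∷ σ) x∈ with Sub.x∈p∪q⁻ P (⋃ σ) x∈
... | inj₁ x∈P = P , here refl , x∈P
... | inj₂ x∈σ with ∈-⋃⁻ σ x∈σ
...   | Q , Q∈σ , x∈Q = Q , there Q∈σ , x∈Q

⁅⁆-injective : ∀ {x y : Fin N} → ⁅ x ⁆ ≡ ⁅ y ⁆ → x ≡ y
⁅⁆-injective {x = x} {y} eq = Sub.x∈⁅y⁆⇒x≡y y (subst (x ∈ₛ_) eq (Sub.x∈⁅x⁆ x))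

⁅⁆-disjoint : ∀ {x y : Fin N} → x ≢ y → Disjoint ⁅ x ⁆ ⁅ y ⁆
⁅⁆-disjoint {x = x} {y} x≢y (z , z∈) with Sub.x∈p∩q⁻ ⁅ x ⁆ ⁅ y ⁆ z∈
... | z∈x , z∈y = x≢y (trans (sym (Sub.x∈⁅y⁆⇒x≡y x z∈x)) (Sub.x∈⁅y⁆⇒x≡y y z∈y))

∈-elements⁺ : ∀ {x : Fin N} {P} → x ∈ₛ P → x ∈ elements P
∈-elements⁺ {P = P} x∈P = ∈-filter⁺ (_∈ₛ? P) (∈-allFin _) x∈P

∈-elements⁻ : ∀ {x : Fin N} P → x ∈ elements P → x ∈ₛ P
∈-elements⁻ P x∈ = proj₂ (∈-filter⁻ (_∈ₛ? P) {xs = allFin _} x∈)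

elements-unique : (P : Subset N) → Unique (elements P)
elements-unique P = Unique.filter⁺ (_∈ₛ? P) (Unique.allFin⁺ _)

singletons : (P : Subset N) → Nonempty P → Ensemble N
singletons P (x , x∈P) = record
  { patterns        = map ⁅_⁆ (elements P)
  ; unique          = Unique.map⁺ ⁅⁆-injective (elements-unique P)
  ; nonempty        = λ eq → Any.¬Any[] (subst (⁅ x ⁆ ∈_) eq (∈-map⁺ ⁅_⁆ (∈-elements⁺ x∈P)))
  ; patternNonempty = All.map⁺ (All.universal (λ y → y , Sub.x∈⁅x⁆ y) (elements P))
  }

filter-⊆ : ∀ {P Q : Subset N} → P ⊆ₛ Q → (xs : List (Fin N)) →
           filter (_∈ₛ? P) xs ⊆ filter (_∈ₛ? Q) xs
filter-⊆ P⊆Q [] = []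
filter-⊆ {P = P} {Q} P⊆Q (x ∷ xs) with x ∈ₛ? P | x ∈ₛ? Q
... | yes _   | yes _   = refl ∷ filter-⊆ P⊆Q xs
... | yes x∈P | no x∉Q  = contradiction (P⊆Q x∈P) x∉Q
... | no _    | yes _   = _ ∷ʳ filter-⊆ P⊆Q xs
... | no _    | no _    = filter-⊆ P⊆Q xs

singletons-▷ : ∀ {P : Subset N} ne (ℬ : Ensemble N) → (∀ {B} → B ∈ patterns ℬ → B ⊆ₛ P) →
               singletons P ne ▷ ℬ
singletons-▷ {P = P} _ ℬ ℬ⊆P = All.tabulate λ {B} B∈ℬ →
  map ⁅_⁆ (elements B) ,
  Sublist.map⁺ ⁅_⁆ (filter-⊆ (ℬ⊆P B∈ℬ) (allFin _)) ,
  AllPairs.map⁺ (AllPairs.map ⁅⁆-disjoint (elements-unique B)) ,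
  Sub.⊆-antisym (fwd B) (bwd B)
  where
  fwd : ∀ B → ⋃ (map ⁅_⁆ (elements B)) ⊆ₛ B
  fwd B x∈ with ∈-⋃⁻ (map ⁅_⁆ (elements B)) x∈
  ... | Q , Q∈ , x∈Q with ∈-map⁻ ⁅_⁆ Q∈
  ...   | y , y∈ , refl with Sub.x∈⁅y⁆⇒x≡y y x∈Q
  ...     | refl = ∈-elements⁻ B y∈
  bwd : ∀ B → B ⊆ₛ ⋃ (map ⁅_⁆ (elements B))
  bwd B {x} x∈B = ∈-⋃⁺ (∈-map⁺ ⁅_⁆ (∈-elements⁺ x∈B)) (Sub.x∈⁅x⁆ x)

supp-nonempty : (ℬ : Ensemble N) → Nonempty (supp ℬ)
supp-nonempty ℬ with patterns ℬ | nonempty ℬ | patternNonempty ℬ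
... | []    | ne | _ = contradiction refl ne
... | B ∷ _ | _  | (x , x∈B) ∷ _ = x , Sub.x∈p∪q⁺ (inj₁ x∈B)

-- Least weight of a path whose intermediate vertices lie in a given list, by
-- induction on that list.  Applied to ensembles, it yields a chain of least weight.
module LeastPath
  (V : Set) (_⟶_ : V → V → Set) (_⟶?_ : ∀ s t → Dec (s ⟶ t)) (cost : V → V → ℕ)
  (_~_ : V → V → Set) (~-refl : ∀ {v} → v ~ v)
  (respʳ : ∀ {s u v} → u ~ v → s ⟶ u → (s ⟶ v) × cost s u ≡ cost s v)
  (respˡ : ∀ {u v t} → u ~ v → u ⟶ t → (v ⟶ t) × cost u t ≡ cost v t)
  where

  data Path (vs : List V) : V → V → Set where
    one  : ∀ {s t} → s ⟶ t → Path vs s t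
    step : ∀ {s u t} → s ⟶ u → Any (u ~_) vs → Path vs u t → Path vs s t

  total : ∀ {vs s t} → Path vs s t → ℕ
  total (one {s} {t} _)        = cost s t
  total (step {s} {u} _ _ p) = cost s u ℕ.+ total p

  weaken : ∀ {v vs s t} (p : Path vs s t) → ∃[ q ] total {v ∷ vs} {s} {t} q ≡ total p
  weaken (one a) = one a , refl
  weaken (step a u∈ p) with weaken p
  ... | q , eq = step a (there u∈) q , cong (_ ℕ.+_) eq

  join : ∀ {v vs s t} (p : Path vs s v) (q : Path vs v t) →
         ∃[ r ] total {v ∷ vs} {s} {t} r ≡ total p ℕ.+ total q
  join (one a) q with weaken q
  ... | q′ , eq = step a (here ~-refl) q′ , cong (_ ℕ.+_) eq
  join (step a u∈ p) q with join p q
  ... | r , eq = step a (there u∈) r , trans (cong (_ ℕ.+_) eq) (sym (ℕ.+-assoc _ (total p) (total q)))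

  restart : ∀ {u v vs t} → u ~ v → (p : Path vs u t) → ∃[ q ] total {vs} {v} {t} q ≡ total p
  restart u~v (one a) with respˡ u~v a
  ... | b , eq = one b , sym eq
  restart u~v (step a w∈ p) with respˡ u~v a
  ... | b , eq = step b w∈ p , cong (ℕ._+ total p) (sym eq)

  Split : V → List V → V → V → ℕ → Set
  Split v vs s t w = (Σ[ p ∈ Path vs s t ] total p ℕ.≤ w)
                   ⊎ (Σ[ p ∈ Path vs s v ] Σ[ q ∈ Path vs v t ] total p ℕ.+ total q ℕ.≤ w)

  split : ∀ {v vs s t} (p : Path (v ∷ vs) s t) → Split v vs s t (total p)
  split (one a) = inj₁ (one a , ℕ.≤-refl)
  split (step {s} {u} a (here u~v) p) with respʳ u~v a | split p
  ... | b , eq | inj₁ (q , q≤) with restart u~v q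
  ...   | q′ , eq′ =
          inj₂ (one b , q′ , ℕ.+-mono-≤ (ℕ.≤-reflexive (sym eq)) (ℕ.≤-trans (ℕ.≤-reflexive eq′) q≤))
  split (step {s} {u} a (here u~v) p) | b , eq | inj₂ (q , r , q+r≤) =
          inj₂ (one b , r , ℕ.+-mono-≤ (ℕ.≤-reflexive (sym eq)) (ℕ.≤-trans (ℕ.m≤n+m (total r) (total q)) q+r≤))
  split (step {s} {u} a (there u∈) p) with split p
  ... | inj₁ (q , q≤) = inj₁ (step a u∈ q , ℕ.+-monoʳ-≤ (cost s u) q≤)
  ... | inj₂ (q , r , q+r≤) =
          inj₂ (step a u∈ q , r ,
                ℕ.≤-trans (ℕ.≤-reflexive (ℕ.+-assoc (cost s u) (total q) (total r)))
                          (ℕ.+-monoʳ-≤ (cost s u) q+r≤))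

  Least : List V → V → V → Set
  Least vs s t = Σ[ p ∈ Path vs s t ] (∀ (q : Path vs s t) → total p ℕ.≤ total q)

  least : ∀ vs s t → Least vs s t ⊎ ¬ Path vs s t
  least [] s t with s ⟶? t
  ... | yes a = inj₁ (one a , λ { (one _) → ℕ.≤-refl ; (step _ () _) })
  ... | no ¬a = inj₂ λ { (one a) → ¬a a ; (step _ () _) }
  least (v ∷ vs) s t = combine′ (least vs s t) (least vs s v) (least vs v t)
    where
    direct : (l : Least vs s t) →
             (∀ (q : Path vs s v) (r : Path vs v t) → total (proj₁ l) ℕ.≤ total q ℕ.+ total r) →
             Least (v ∷ vs) s t ⊎ ¬ Path (v ∷ vs) s t
    direct (p , p-least) p≤ with weaken {v} p
    ... | p′ , eq = inj₁ (p′ , λ q → ℕ.≤-trans (ℕ.≤-reflexive eq) (bound (split q)))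
      where
      bound : ∀ {w} → Split v vs s t w → total p ℕ.≤ w
      bound (inj₁ (q , q≤))       = ℕ.≤-trans (p-least q) q≤
      bound (inj₂ (q , r , q+r≤)) = ℕ.≤-trans (p≤ q r) q+r≤

    via : (l : Least vs s v) (m : Least vs v t) →
          (∀ (p : Path vs s t) → total (proj₁ l) ℕ.+ total (proj₁ m) ℕ.≤ total p) →
          Least (v ∷ vs) s t ⊎ ¬ Path (v ∷ vs) s t
    via (p , p-least) (q , q-least) ≤p with join p q
    ... | r , eq = inj₁ (r , λ q′ → ℕ.≤-trans (ℕ.≤-reflexive eq) (bound (split q′)))
      where
      bound : ∀ {w} → Split v vs s t w → total p ℕ.+ total q ℕ.≤ w
      bound (inj₁ (q′ , q′≤))       = ℕ.≤-trans (≤p q′) q′≤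
      bound (inj₂ (p′ , q′ , ≤w))   = ℕ.≤-trans (ℕ.+-mono-≤ (p-least p′) (q-least q′)) ≤w

    combine′ : Least vs s t ⊎ ¬ Path vs s t → Least vs s v ⊎ ¬ Path vs s v →
               Least vs v t ⊎ ¬ Path vs v t → Least (v ∷ vs) s t ⊎ ¬ Path (v ∷ vs) s t
    combine′ (inj₁ l) (inj₂ ¬q) _         = direct l (λ q _ → contradiction q ¬q)
    combine′ (inj₁ l) (inj₁ _) (inj₂ ¬r)  = direct l (λ _ r → contradiction r ¬r)
    combine′ (inj₁ l) (inj₁ m) (inj₁ m′)
      with ℕ.≤-total (total (proj₁ l)) (total (proj₁ m) ℕ.+ total (proj₁ m′))
    ... | inj₁ ≤ᵐ = direct l (λ q r → ℕ.≤-trans ≤ᵐ (ℕ.+-mono-≤ (proj₂ m q) (proj₂ m′ r)))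
    ... | inj₂ ≥ᵐ = via m m′ (λ p → ℕ.≤-trans ≥ᵐ (proj₂ l p))
    combine′ (inj₂ ¬p) (inj₁ m) (inj₁ m′) = via m m′ (λ p → contradiction p ¬p)
    combine′ (inj₂ ¬p) (inj₂ ¬q) _ = inj₂ λ r → absurd (split r)
      where
      absurd : ∀ {w} → ¬ Split v vs s t w
      absurd (inj₁ (p , _))     = ¬p p
      absurd (inj₂ (q , _ , _)) = ¬q q
    combine′ (inj₂ ¬p) (inj₁ _) (inj₂ ¬q) = inj₂ λ r → absurd (split r)
      where
      absurd : ∀ {w} → ¬ Split v vs s t w
      absurd (inj₁ (p , _))     = ¬p p
      absurd (inj₂ (_ , q , _)) = ¬q q

allSubsets : ∀ N → List (Subset N)
allSubsets zero    = Vec.[] ∷ []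
allSubsets (suc N) = cartesianProductWith Vec._∷_ (true ∷ false ∷ []) (allSubsets N)

∈-allSubsets : (P : Subset N) → P ∈ allSubsets N
∈-allSubsets Vec.[]          = here refl
∈-allSubsets (true Vec.∷ P)  = ∈-cartesianProductWith⁺ Vec._∷_ {xs = true ∷ false ∷ []} (here refl) (∈-allSubsets P)
∈-allSubsets (false Vec.∷ P) = ∈-cartesianProductWith⁺ Vec._∷_ {xs = true ∷ false ∷ []} (there (here refl)) (∈-allSubsets P)

lists : ∀ {A : Set} → List A → ℕ → List (List A)
lists as zero    = [] ∷ []
lists as (suc k) = [] ∷ cartesianProductWith _∷_ as (lists as k)

∈-lists : ∀ {A : Set} {as : List A} → (∀ a → a ∈ as) → ∀ {k} xs → length xs ℕ.≤ k → xs ∈ lists as k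
∈-lists all {zero}  []       _         = here refl
∈-lists all {suc k} []       _         = here refl
∈-lists all {suc k} (x ∷ xs) (s≤s len) = there (∈-cartesianProductWith⁺ _∷_ (all x) (∈-lists all xs len))

lookup-inj : ∀ {A : Set} {xs : List A} → Unique xs → ∀ i j → lookup xs i ≡ lookup xs j → i ≡ j
lookup-inj (_ ∷ _)  fzero       fzero       _  = refl
lookup-inj (x∉ ∷ _) fzero       (Fin.suc j) eq = contradiction eq (All.lookup x∉ (∈-lookup j))
lookup-inj (x∉ ∷ _) (Fin.suc i) fzero       eq = contradiction (sym eq) (All.lookup x∉ (∈-lookup i))
lookup-inj (_ ∷ u)  (Fin.suc i) (Fin.suc j) eq = cong Fin.suc (lookup-inj u i j eq)

unique-length-≤ : ∀ {A : Set} {as : List A} → (∀ a → a ∈ as) → ∀ {xs} → Unique xs → length xs ℕ.≤ length as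
unique-length-≤ {A} all {xs} u = Fin.injective⇒≤ {f = index ∘ all ∘ lookup xs} λ {i} {j} eq →
  lookup-inj u i j (SetoidMembership.index-injective (≡-setoid A) (all (lookup xs i)) (all (lookup xs j)) eq)
  where open import Relation.Binary.PropositionalEquality.Properties using () renaming (setoid to ≡-setoid)

toEnsemble : (Ps : List (Subset N)) → Dec (Σ[ 𝒜 ∈ Ensemble N ] patterns 𝒜 ≡ Ps)
toEnsemble Ps = map′ build decompose
  (allPairs? (λ P Q → ¬? (P ≟ₛ Q)) Ps ×-dec nonempty′ Ps ×-dec All.all? nonempty? Ps)
  where
  nonempty′ : ∀ {A : Set} (xs : List A) → Dec (xs ≢ [])
  nonempty′ []      = no λ ne → ne refl
  nonempty′ (_ ∷ _) = yes λ ()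
  build : Unique Ps × Ps ≢ [] × All Nonempty Ps → Σ[ 𝒜 ∈ Ensemble _ ] patterns 𝒜 ≡ Ps
  build (u , ne , p) = record { patterns = Ps ; unique = u ; nonempty = ne ; patternNonempty = p } , refl
  decompose : Σ[ 𝒜 ∈ Ensemble _ ] patterns 𝒜 ≡ Ps → Unique Ps × Ps ≢ [] × All Nonempty Ps
  decompose (𝒜 , refl) = unique 𝒜 , nonempty 𝒜 , patternNonempty 𝒜

toEnsembles : List (List (Subset N)) → List (Ensemble N)
toEnsembles []         = []
toEnsembles (Ps ∷ Pss) with toEnsemble Ps
... | yes (𝒜 , _) = 𝒜 ∷ toEnsembles Pss
... | no _        = toEnsembles Pss

_~_ : Ensemble N → Ensemble N → Set
𝒜 ~ ℬ = patterns 𝒜 ≡ patterns ℬ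

∈-toEnsembles : (𝒜 : Ensemble N) → ∀ {Pss} → patterns 𝒜 ∈ Pss → Any (𝒜 ~_) (toEnsembles Pss)
∈-toEnsembles 𝒜 {Ps ∷ Pss} (here refl) with toEnsemble Ps
... | yes (_ , eq) = here (sym eq)
... | no ¬𝒜        = contradiction (𝒜 , refl) ¬𝒜
∈-toEnsembles 𝒜 {Ps ∷ Pss} (there 𝒜∈) with toEnsemble Ps
... | yes _ = there (∈-toEnsembles 𝒜 𝒜∈)
... | no _  = ∈-toEnsembles 𝒜 𝒜∈

allEnsembles : ∀ N → List (Ensemble N)
allEnsembles N = toEnsembles (lists (allSubsets N) (length (allSubsets N)))

∈-allEnsembles : (𝒜 : Ensemble N) → Any (𝒜 ~_) (allEnsembles N)
∈-allEnsembles 𝒜 = ∈-toEnsembles 𝒜 (∈-lists ∈-allSubsets (patterns 𝒜) (unique-length-≤ ∈-allSubsets (unique 𝒜)))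

_▷?_ : (𝒜 ℬ : Ensemble N) → Dec (𝒜 ▷ ℬ)
𝒜 ▷? ℬ = All.all? decomposable? (patterns ℬ)
  where
  decomposable? : ∀ B → Dec (∃[ σ ] σ ⊆ patterns 𝒜 × σ PartitionOf B)
  decomposable? B = map′ to from (Any.any? (partitionOf? B) (sublists (patterns 𝒜)))
    where
    open import Data.List.Membership.Propositional using (find; lose)
    to : Any (_PartitionOf B) (sublists (patterns 𝒜)) → ∃[ σ ] σ ⊆ patterns 𝒜 × σ PartitionOf B
    to any with find any
    ... | σ , σ∈ , part = σ , ∈-sublists⁻ _ σ∈ , part
    from : ∃[ σ ] σ ⊆ patterns 𝒜 × σ PartitionOf B → Any (_PartitionOf B) (sublists (patterns 𝒜))
    from (σ , σ⊆ , part) = lose (∈-sublists⁺ σ⊆) part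

self-partition : (B : Subset N) → (B ∷ []) PartitionOf B
self-partition B = [] ∷ [] ,
  Sub.⊆-antisym (λ x∈ → Sum.[ id , (λ x∈∅ → contradiction x∈∅ Sub.∉⊥) ] (Sub.x∈p∪q⁻ B ∅ x∈))
                (λ x∈ → Sub.x∈p∪q⁺ (inj₁ x∈))

▷-refl : (𝒜 : Ensemble N) → 𝒜 ▷ 𝒜
▷-refl 𝒜 = All.tabulate λ {B} B∈ → B ∷ [] , from∈ B∈ , self-partition B

∣▷-refl∣ : (𝒜 : Ensemble N) → ∣ 𝒜 ▷ 𝒜 ∣ ≡ 0
∣▷-refl∣ 𝒜 = zeros (patterns 𝒜) id
  where
  zeros : ∀ Ps → (∀ {B} → B ∈ Ps → B ∈ patterns 𝒜) → sum (map (ω 𝒜) Ps) ≡ 0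
  zeros []       _   = refl
  zeros (B ∷ Ps) Ps⊆ = cong₂ ℕ._+_
    (ℕ.m≤n⇒m∸n≡0 (leastSize-≤ 𝒜 (from∈ (Ps⊆ (here refl))) (self-partition B)))
    (zeros Ps (Ps⊆ ∘ there))

MinimalChain : Ensemble N → Ensemble N → Set
MinimalChain 𝒜 ℬ = Σ[ ℭ ∈ Chain 𝒜 ℬ ] (∀ (ℭ′ : Chain 𝒜 ℬ) → weight ℭ ℕ.≤ weight ℭ′)

-- Up to the proof components of its members, allEnsembles N is exhaustive, so
-- chains are the paths through it.
minimalChain : (𝒜 ℬ : Ensemble N) → Chain 𝒜 ℬ → MinimalChain 𝒜 ℬ
minimalChain {N} 𝒜 ℬ ℭ₀ = fromLeast (least (allEnsembles N) 𝒜 ℬ)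
  where
  respʳ : ∀ {𝒜 ℬ 𝒞 : Ensemble N} → ℬ ~ 𝒞 → 𝒜 ▷ ℬ → (𝒜 ▷ 𝒞) × ∣ 𝒜 ▷ ℬ ∣ ≡ ∣ 𝒜 ▷ 𝒞 ∣
  respʳ {𝒜} ℬ~𝒞 a = subst (All _) ℬ~𝒞 a , cong (sum ∘ map (ω 𝒜)) ℬ~𝒞
  respˡ : ∀ {𝒜 ℬ 𝒞 : Ensemble N} → 𝒜 ~ ℬ → 𝒜 ▷ 𝒞 → (ℬ ▷ 𝒞) × ∣ 𝒜 ▷ 𝒞 ∣ ≡ ∣ ℬ ▷ 𝒞 ∣
  respˡ {𝒞 = 𝒞} 𝒜~ℬ a =
    All.map (λ (σ , σ⊆ , part) → σ , subst (σ ⊆_) 𝒜~ℬ σ⊆ , part) a ,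
    cong (λ Ps → sum (map (λ B → min (length Ps) (map length (filter (partitionOf? B) (sublists Ps))) ∸ 1)
                          (patterns 𝒞))) 𝒜~ℬ
  open LeastPath (Ensemble N) _▷_ _▷?_ ∣_▷_∣ _~_ refl
    (λ {s} {u} {v} → respʳ {s} {u} {v}) (λ {u} {v} {t} → respˡ {u} {v} {t})

  toChain : ∀ {vs 𝒜 ℬ} (p : Path vs 𝒜 ℬ) → Σ[ ℭ ∈ Chain 𝒜 ℬ ] weight ℭ ≡ total p
  toChain (one a) = a ∷ [] , ℕ.+-identityʳ _
  toChain (step a _ p) with toChain p
  ... | ℭ , eq = a ∷ ℭ , cong (_ ℕ.+_) eq

  toPath : ∀ {𝒜 ℬ} (ℭ : Chain 𝒜 ℬ) → Σ[ p ∈ Path (allEnsembles N) 𝒜 ℬ ] total p ≡ weight ℭ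
  toPath {𝒜} [] = one (▷-refl 𝒜) , ∣▷-refl∣ 𝒜
  toPath (_∷_ {ℬ = ℬ} a ℭ) with toPath ℭ
  ... | p , eq = step a (∈-allEnsembles ℬ) p , cong (_ ℕ.+_) eq

  fromLeast : Least (allEnsembles N) 𝒜 ℬ ⊎ ¬ Path (allEnsembles N) 𝒜 ℬ → MinimalChain 𝒜 ℬ
  fromLeast (inj₂ ¬p) = contradiction (proj₁ (toPath ℭ₀)) ¬p
  fromLeast (inj₁ (p , p-least)) with toChain p
  ... | ℭ , eq = ℭ , λ ℭ′ → let (q , eq′) = toPath ℭ′ in
        subst₂ ℕ._≤_ (sym eq) eq′ (p-least q)

supports : Ensemble N → Ensemble N
supports ℬ = singletons (supp ℬ) (supp-nonempty ℬ)

minimal : (ℬ : Ensemble N) → MinimalChain (supports ℬ) ℬ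
minimal ℬ = minimalChain (supports ℬ) ℬ
  (singletons-▷ (supp-nonempty ℬ) ℬ (λ B∈ x∈B → ∈-⋃⁺ B∈ x∈B) ∷ [])

μ : Ensemble N → ℕ
μ ℬ = weight (proj₁ (minimal ℬ))

[_] : ℚᵘ → ℤ
[ t ] = ℚ.floor (t ℚ.+ ℚ.½)

image-nonempty : ∀ {M} (g : Fin M → Fin N) {P} → Nonempty P → Nonempty (image g P)
image-nonempty g (x , x∈P) =
  g x , ∈-⋃⁺ (∈-map⁺ (⁅_⁆ ∘ g) (∈-elements⁺ x∈P)) (Sub.x∈⁅x⁆ (g x))

module _ (n : ℕ) .{{_ : NonTrivial n}} where

  private
    instance
      n≢0 : NonZero n
      n≢0 = ℕ.nonTrivial⇒nonZero n

      n-1≢0 : NonZero (n ∸ 1)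
      n-1≢0 = ℕ.>-nonZero (ℕ.m<n⇒0<n∸m (ℕ.nonTrivial⇒n>1 n))

    origin : Fin n
    origin = fromℕ< (ℕ.>-nonZero⁻¹ n)

  -- Below, the pixel (x , y) is represented by `combine x y : Fin (n * n)`.

  modₙ : ℤ → Fin n
  modₙ m = fromℕ< (ℤ.n%ℕd<d m n)

  shift : ℤ → Fin (n ℕ.* n) → Fin (n ℕ.* n)
  shift s p = let (x , y) = remQuot {n} n p in combine x (modₙ (+ toℕ y ℤ.+ s))

  hat : (Fin n → Fin n) → Fin n → Fin (n ℕ.* n)
  hat f x = combine x (f x)

  baseFunction : Fin n → Fin n → Fin n
  baseFunction e x = modₙ [ (+ toℕ e ℚ./ (n ∸ 1)) ℚ.* (+ toℕ x ℚ./ 1) ]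

  houghPattern : Fin n → Fin n → Subset (n ℕ.* n)
  houghPattern e s = image (shift (+ toℕ s)) (image (hat (baseFunction e)) full)

  houghPatterns : List (Subset (n ℕ.* n))
  houghPatterns = cartesianProductWith houghPattern (allFin n) (allFin n)

  houghEnsemble : Ensemble (n ℕ.* n)
  houghEnsemble = record
    { patterns        = deduplicate _≟ₛ_ houghPatterns
    ; unique          = Unique.deduplicate-! _≟ₛ_ houghPatterns
    ; nonempty        = λ eq → Any.¬Any[] (subst (houghPattern origin origin ∈_) eq
                          (∈-deduplicate⁺ _≟ₛ_
                            (∈-cartesianProductWith⁺ houghPattern (∈-allFin origin) (∈-allFin origin))))
    ; patternNonempty = All.tabulate λ P∈ → all-nonempty (∈-deduplicate⁻ _≟ₛ_ houghPatterns P∈)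
    }
    where
    all-nonempty : ∀ {P} → P ∈ houghPatterns → Nonempty P
    all-nonempty P∈ with ∈-cartesianProductWith⁻ houghPattern (allFin n) (allFin n) P∈
    ... | e , s , _ , _ , refl =
      image-nonempty (shift (+ toℕ s)) (image-nonempty (hat (baseFunction e)) (origin , Sub.∈⊤))

  pixels : Ensemble (n ℕ.* n)
  pixels = singletons full (combine origin origin , Sub.∈⊤)

record ℝ : Set where
  no-eta-equality
  field
    approx : ℕ → ℚᵘ
    cauchy : ∀ ε → 0ℚᵘ ℚ.< ε → ∃[ K ] ∀ j k → K ℕ.≤ j → K ℕ.≤ k → ℚ.∣ approx j ℚ.- approx k ∣ ℚ.≤ ε

open ℝ public

infix  4 _<ᴿ_ _≤ᴿ_
infixl 6 _+ᴿ_ _-ᴿ_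
infixl 7 _*ᴿ_ _/ᴿ_
infix  8 -ᴿ_

_<ᴿ_ : ℝ → ℝ → Set
x <ᴿ y = ∃[ ε ] 0ℚᵘ ℚ.< ε × ∃[ K ] ∀ k → K ℕ.≤ k → approx x k ℚ.+ ε ℚ.≤ approx y k

_≤ᴿ_ : ℝ → ℝ → Set
x ≤ᴿ y = ∀ ε → 0ℚᵘ ℚ.< ε → ∃[ K ] ∀ k → K ℕ.≤ k → approx x k ℚ.≤ approx y k ℚ.+ ε

private
  *-pos : ∀ {p q} → 0ℚᵘ ℚ.< p → 0ℚᵘ ℚ.< q → 0ℚᵘ ℚ.< p ℚ.* q
  *-pos {p} {q} p>0 q>0 = ℚ.positive⁻¹ (p ℚ.* q) {{ℚ.pos*pos⇒pos p {{ℚ.positive p>0}} q {{ℚ.positive q>0}}}}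

  +-pos : ∀ {p q} → 0ℚᵘ ℚ.< p → 0ℚᵘ ℚ.< q → 0ℚᵘ ℚ.< p ℚ.+ q
  +-pos {p} {q} p>0 q>0 = ℚ.positive⁻¹ (p ℚ.+ q) {{ℚ.pos+pos⇒pos p {{ℚ.positive p>0}} q {{ℚ.positive q>0}}}}

  *-mono : ∀ {p q r s} → 0ℚᵘ ℚ.≤ p → 0ℚᵘ ℚ.≤ r → p ℚ.≤ q → r ℚ.≤ s → p ℚ.* r ℚ.≤ q ℚ.* s
  *-mono p≥0 r≥0 = ℚ.*-mono-≤-nonNeg {{ℚ.nonNegative p≥0}} {{ℚ.nonNegative r≥0}}

  /-≤ : ∀ a b d e → a ℕ.* suc e ℕ.≤ b ℕ.* suc d → + a ℚ./ suc d ℚ.≤ + b ℚ./ suc e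
  /-≤ a b d e le = ℚ.*≤* (subst₂ ℤ._≤_ (ℤ.pos-* a (suc e)) (ℤ.pos-* b (suc d)) (ℤ.+≤+ le))

  0<1 : 0ℚᵘ ℚ.< 1ℚᵘ
  0<1 = ℚ.positive⁻¹ 1ℚᵘ

  0<½ : 0ℚᵘ ℚ.< ℚ.½
  0<½ = ℚ.positive⁻¹ ℚ.½

  ∣∣-≤ : ∀ {p ε} → p ℚ.≤ ε → ℚ.- p ℚ.≤ ε → ℚ.∣ p ∣ ℚ.≤ ε
  ∣∣-≤ {p} p≤ -p≤ with ℚ.∣p∣≡p∨∣p∣≡-p p
  ... | inj₁ eq = subst (ℚ._≤ _) (sym eq) p≤
  ... | inj₂ eq = subst (ℚ._≤ _) (sym eq) -p≤

  p-q≤r : ∀ {p q r} → p ℚ.≤ q ℚ.+ r → p ℚ.- q ℚ.≤ r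
  p-q≤r {p} {q} {r} p≤ = ℚ.≤-trans (ℚ.+-monoˡ-≤ (ℚ.- q) p≤)
    (ℚ.≤-reflexive (solve 2 (λ q r → q :+ r :- q := r) ℚ.≃-refl q r))
    where open ℚ-Solver

fromℚ : ℚᵘ → ℝ
approx (fromℚ q) _     = q
cauchy (fromℚ q) ε ε>0 = 0 , λ _ _ _ _ →
  ℚ.≤-trans (ℚ.≤-reflexive (ℚ.∣-∣-cong (ℚ.+-inverseʳ q))) (ℚ.<⇒≤ ε>0)

fromℕ : ℕ → ℝ
fromℕ m = fromℚ (+ m ℚ./ 1)

_+ᴿ_ : ℝ → ℝ → ℝ
approx (x +ᴿ y) k     = approx x k ℚ.+ approx y k
cauchy (x +ᴿ y) ε ε>0
  with cauchy x (ε ℚ.* ℚ.½) (*-pos ε>0 0<½) | cauchy y (ε ℚ.* ℚ.½) (*-pos ε>0 0<½)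
... | K , x-close | L , y-close = K ℕ.⊔ L , λ j k K≤j K≤k →
  let a = approx x j; b = approx y j; c = approx x k; d = approx y k in begin
  ℚ.∣ (a ℚ.+ b) ℚ.- (c ℚ.+ d) ∣          ≃⟨ ℚ.∣-∣-cong (solve 4 (λ a b c d → a :+ b :- (c :+ d) := (a :- c) :+ (b :- d)) ℚ.≃-refl a b c d) ⟩
  ℚ.∣ (a ℚ.- c) ℚ.+ (b ℚ.- d) ∣          ≤⟨ ℚ.∣p+q∣≤∣p∣+∣q∣ (a ℚ.- c) (b ℚ.- d) ⟩
  ℚ.∣ a ℚ.- c ∣ ℚ.+ ℚ.∣ b ℚ.- d ∣          ≤⟨ ℚ.+-mono-≤ (x-close j k (ℕ.m⊔n≤o⇒m≤o K L K≤j) (ℕ.m⊔n≤o⇒m≤o K L K≤k))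
                                                     (y-close j k (ℕ.m⊔n≤o⇒n≤o K L K≤j) (ℕ.m⊔n≤o⇒n≤o K L K≤k)) ⟩
  ε ℚ.* ℚ.½ ℚ.+ ε ℚ.* ℚ.½              ≃⟨ ℚ.*-distribˡ-+ ε ℚ.½ ℚ.½ ⟨
  ε ℚ.* (ℚ.½ ℚ.+ ℚ.½)                  ≃⟨ ℚ.*-congˡ {ε} {y = 1ℚᵘ} (ℚ.*≡* refl) ⟩
  ε ℚ.* 1ℚᵘ                            ≃⟨ ℚ.*-identityʳ ε ⟩
  ε                                    ∎
  where
  open ℚ.≤-Reasoning
  open ℚ-Solver

-ᴿ_ : ℝ → ℝ
approx (-ᴿ x) k     = ℚ.- approx x k
cauchy (-ᴿ x) ε ε>0 with cauchy x ε ε>0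
... | K , x-close = K , λ j k K≤j K≤k → ℚ.≤-trans
  (ℚ.≤-reflexive (ℚ.∣-∣-cong (solve 2 (λ a b → :- a :- (:- b) := b :- a) ℚ.≃-refl (approx x j) (approx x k))))
  (x-close k j K≤k K≤j)
  where open ℚ-Solver

_-ᴿ_ : ℝ → ℝ → ℝ
x -ᴿ y = x +ᴿ (-ᴿ y)

bounded : ∀ x → ∃[ A ] 0ℚᵘ ℚ.< A × ∃[ K ] ∀ k → K ℕ.≤ k → ℚ.∣ approx x k ∣ ℚ.≤ A
bounded x with cauchy x 1ℚᵘ 0<1
... | K , x-close = ℚ.∣ approx x K ∣ ℚ.+ 1ℚᵘ ,
  ℚ.<-≤-trans 0<1 (ℚ.≤-trans (ℚ.≤-reflexive (ℚ.≃-sym (ℚ.+-identityˡ 1ℚᵘ))) (ℚ.+-monoˡ-≤ 1ℚᵘ (ℚ.0≤∣p∣ (approx x K)))) ,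
  K , λ k K≤k → let a = approx x k; c = approx x K in begin
  ℚ.∣ a ∣                        ≃⟨ ℚ.∣-∣-cong (solve 2 (λ a c → a := c :+ (a :- c)) ℚ.≃-refl a c) ⟩
  ℚ.∣ c ℚ.+ (a ℚ.- c) ∣          ≤⟨ ℚ.∣p+q∣≤∣p∣+∣q∣ c (a ℚ.- c) ⟩
  ℚ.∣ c ∣ ℚ.+ ℚ.∣ a ℚ.- c ∣        ≤⟨ ℚ.+-monoʳ-≤ ℚ.∣ c ∣ (x-close k K K≤k ℕ.≤-refl) ⟩
  ℚ.∣ c ∣ ℚ.+ 1ℚᵘ                ∎
  where
  open ℚ.≤-Reasoning
  open ℚ-Solver

-- Total, with inv 0 = 0, so that reciprocals of approximations can be taken
-- termwise even where finitely many of them vanish.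
inv : ℚᵘ → ℚᵘ
inv p@(mkℚᵘ (+ 0)       _) = 0ℚᵘ
inv p@(mkℚᵘ ℤ.+[1+ _ ]  _) = ℚ.1/ p
inv p@(mkℚᵘ ℤ.-[1+ _ ]  _) = ℚ.1/ p

inv-inverse : ∀ {p} → 0ℚᵘ ℚ.< p → p ℚ.* inv p ℚ.≃ 1ℚᵘ
inv-inverse {mkℚᵘ (+ 0)      _} p>0 with () ← ℚ.positive p>0
inv-inverse {p@(mkℚᵘ ℤ.+[1+ _ ] _)} _ = ℚ.*-inverseʳ p
inv-inverse {mkℚᵘ ℤ.-[1+ _ ] _} p>0 with () ← ℚ.positive p>0

inv-pos : ∀ {p} → 0ℚᵘ ℚ.< p → 0ℚᵘ ℚ.< inv p
inv-pos {mkℚᵘ (+ 0)      _} p>0 with () ← ℚ.positive p>0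
inv-pos {p@(mkℚᵘ ℤ.+[1+ _ ] _)} _ = ℚ.positive⁻¹ (ℚ.1/ p)
inv-pos {mkℚᵘ ℤ.-[1+ _ ] _} p>0 with () ← ℚ.positive p>0

inv-antimono : ∀ {p q} → 0ℚᵘ ℚ.< p → p ℚ.≤ q → inv q ℚ.≤ inv p
inv-antimono {p} {q} p>0 p≤q = begin
  inv q                        ≃⟨ ℚ.*-identityʳ (inv q) ⟨
  inv q ℚ.* 1ℚᵘ                ≃⟨ ℚ.*-congˡ {inv q} (inv-inverse p>0) ⟨
  inv q ℚ.* (p ℚ.* inv p)      ≤⟨ ℚ.*-monoʳ-≤-nonNeg (inv q) {{≥0 (inv-pos q>0)}} (ℚ.*-monoˡ-≤-nonNeg (inv p) {{≥0 (inv-pos p>0)}} p≤q) ⟩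
  inv q ℚ.* (q ℚ.* inv p)      ≃⟨ solve 3 (λ a b c → a :* (b :* c) := (b :* a) :* c) ℚ.≃-refl (inv q) q (inv p) ⟩
  q ℚ.* inv q ℚ.* inv p        ≃⟨ ℚ.*-congʳ {inv p} (inv-inverse q>0) ⟩
  1ℚᵘ ℚ.* inv p                ≃⟨ ℚ.*-identityˡ (inv p) ⟩
  inv p                        ∎
  where
  open ℚ.≤-Reasoning
  open ℚ-Solver
  ≥0 : ∀ {r} → 0ℚᵘ ℚ.< r → ℚ.NonNegative r
  ≥0 r>0 = ℚ.nonNegative (ℚ.<⇒≤ r>0)
  q>0 = ℚ.<-≤-trans p>0 p≤q

_*ᴿ_ : ℝ → ℝ → ℝ
approx (x *ᴿ y) k     = approx x k ℚ.* approx y k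
cauchy (x *ᴿ y) ε ε>0 with bounded x | bounded y
... | A , A>0 , K₁ , x≤A | B , B>0 , K₂ , y≤B
  with cauchy x (ε ℚ.* inv (A ℚ.+ B)) (*-pos ε>0 (inv-pos (+-pos A>0 B>0)))
     | cauchy y (ε ℚ.* inv (A ℚ.+ B)) (*-pos ε>0 (inv-pos (+-pos A>0 B>0)))
... | K₃ , x-close | K₄ , y-close = K₁ ℕ.⊔ K₂ ℕ.⊔ (K₃ ℕ.⊔ K₄) , λ j k K≤j K≤k →
  let a = approx x j; b = approx y j; c = approx x k; d = approx y k
      K₁₂≤j = ℕ.m⊔n≤o⇒m≤o (K₁ ℕ.⊔ K₂) _ K≤j
      K₁₂≤k = ℕ.m⊔n≤o⇒m≤o (K₁ ℕ.⊔ K₂) _ K≤k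
      K₃₄≤j = ℕ.m⊔n≤o⇒n≤o (K₁ ℕ.⊔ K₂) _ K≤j
      K₃₄≤k = ℕ.m⊔n≤o⇒n≤o (K₁ ℕ.⊔ K₂) _ K≤k
  in begin
  ℚ.∣ a ℚ.* b ℚ.- c ℚ.* d ∣                            ≃⟨ ℚ.∣-∣-cong (solve 4 (λ a b c d → a :* b :- c :* d := a :* (b :- d) :+ (a :- c) :* d) ℚ.≃-refl a b c d) ⟩
  ℚ.∣ a ℚ.* (b ℚ.- d) ℚ.+ (a ℚ.- c) ℚ.* d ∣            ≤⟨ ℚ.∣p+q∣≤∣p∣+∣q∣ (a ℚ.* (b ℚ.- d)) ((a ℚ.- c) ℚ.* d) ⟩
  ℚ.∣ a ℚ.* (b ℚ.- d) ∣ ℚ.+ ℚ.∣ (a ℚ.- c) ℚ.* d ∣        ≃⟨ ℚ.+-cong (ℚ.∣p*q∣≃∣p∣*∣q∣ a (b ℚ.- d)) (ℚ.∣p*q∣≃∣p∣*∣q∣ (a ℚ.- c) d) ⟩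
  ℚ.∣ a ∣ ℚ.* ℚ.∣ b ℚ.- d ∣ ℚ.+ ℚ.∣ a ℚ.- c ∣ ℚ.* ℚ.∣ d ∣    ≤⟨ ℚ.+-mono-≤
        (*-mono (ℚ.0≤∣p∣ a) (ℚ.0≤∣p∣ (b ℚ.- d)) (x≤A j (ℕ.m⊔n≤o⇒m≤o K₁ K₂ K₁₂≤j)) (y-close j k (ℕ.m⊔n≤o⇒n≤o K₃ K₄ K₃₄≤j) (ℕ.m⊔n≤o⇒n≤o K₃ K₄ K₃₄≤k)))
        (*-mono (ℚ.0≤∣p∣ (a ℚ.- c)) (ℚ.0≤∣p∣ d) (x-close j k (ℕ.m⊔n≤o⇒m≤o K₃ K₄ K₃₄≤j) (ℕ.m⊔n≤o⇒m≤o K₃ K₄ K₃₄≤k)) (y≤B k (ℕ.m⊔n≤o⇒n≤o K₁ K₂ K₁₂≤k))) ⟩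
  A ℚ.* (ε ℚ.* inv (A ℚ.+ B)) ℚ.+ ε ℚ.* inv (A ℚ.+ B) ℚ.* B  ≃⟨ solve 4 (λ A B e i → A :* (e :* i) :+ e :* i :* B := e :* ((A :+ B) :* i)) ℚ.≃-refl A B ε (inv (A ℚ.+ B)) ⟩
  ε ℚ.* ((A ℚ.+ B) ℚ.* inv (A ℚ.+ B))                ≃⟨ ℚ.*-congˡ {ε} (inv-inverse (+-pos A>0 B>0)) ⟩
  ε ℚ.* 1ℚᵘ                                          ≃⟨ ℚ.*-identityʳ ε ⟩
  ε                                                  ∎
  where
  open ℚ.≤-Reasoning
  open ℚ-Solver

record Positive (x : ℝ) : Set where
  constructor positive
  field positive⁻¹ : fromℕ 0 <ᴿ x

recip : (x : ℝ) → {{Positive x}} → ℝ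
approx (recip x)     k     = inv (approx x k)
cauchy (recip x {{positive (c , c>0 , K , c≤x)}}) ε ε>0
  with cauchy x (ε ℚ.* (c ℚ.* c)) (*-pos ε>0 (*-pos c>0 c>0))
... | L , x-close = K ℕ.⊔ L , λ j k K≤j K≤k →
  let a   = approx x j
      b   = approx x k
      c≤a = c≤ j (ℕ.m⊔n≤o⇒m≤o K L K≤j)
      c≤b = c≤ k (ℕ.m⊔n≤o⇒m≤o K L K≤k)
      a>0 = ℚ.<-≤-trans c>0 c≤a
      b>0 = ℚ.<-≤-trans c>0 c≤b
      ia≥0 = ℚ.<⇒≤ (inv-pos a>0)
      ib≥0 = ℚ.<⇒≤ (inv-pos b>0)
      iab≥0 = ℚ.<⇒≤ (*-pos (inv-pos a>0) (inv-pos b>0))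
  in begin
  ℚ.∣ inv a ℚ.- inv b ∣                              ≃⟨ ℚ.∣-∣-cong (difference a>0 b>0) ⟩
  ℚ.∣ (b ℚ.- a) ℚ.* (inv a ℚ.* inv b) ∣              ≃⟨ ℚ.∣p*q∣≃∣p∣*∣q∣ (b ℚ.- a) (inv a ℚ.* inv b) ⟩
  ℚ.∣ b ℚ.- a ∣ ℚ.* ℚ.∣ inv a ℚ.* inv b ∣              ≃⟨ ℚ.*-congˡ {ℚ.∣ b ℚ.- a ∣} (ℚ.0≤p⇒∣p∣≃p iab≥0) ⟩
  ℚ.∣ b ℚ.- a ∣ ℚ.* (inv a ℚ.* inv b)                ≤⟨ *-mono (ℚ.0≤∣p∣ (b ℚ.- a)) iab≥0
                                                        (x-close k j (ℕ.m⊔n≤o⇒n≤o K L K≤k) (ℕ.m⊔n≤o⇒n≤o K L K≤j))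
                                                        (*-mono ia≥0 ib≥0 (inv-antimono c>0 c≤a) (inv-antimono c>0 c≤b)) ⟩
  ε ℚ.* (c ℚ.* c) ℚ.* (inv c ℚ.* inv c)            ≃⟨ solve 3 (λ e c i → e :* (c :* c) :* (i :* i) := e :* ((c :* i) :* (c :* i))) ℚ.≃-refl ε c (inv c) ⟩
  ε ℚ.* ((c ℚ.* inv c) ℚ.* (c ℚ.* inv c))          ≃⟨ ℚ.*-congˡ {ε} (ℚ.*-cong (inv-inverse c>0) (inv-inverse c>0)) ⟩
  ε ℚ.* (1ℚᵘ ℚ.* 1ℚᵘ)                              ≃⟨ ℚ.*-identityʳ ε ⟩
  ε                                                ∎
  where
  open ℚ.≤-Reasoning
  open ℚ-Solver
  c≤ : ∀ k → K ℕ.≤ k → c ℚ.≤ approx x k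
  c≤ k K≤k = ℚ.≤-trans (ℚ.≤-reflexive (ℚ.≃-sym (ℚ.+-identityˡ c))) (c≤x k K≤k)
  difference : ∀ {a b} → 0ℚᵘ ℚ.< a → 0ℚᵘ ℚ.< b → inv a ℚ.- inv b ℚ.≃ (b ℚ.- a) ℚ.* (inv a ℚ.* inv b)
  difference {a} {b} a>0 b>0 = begin-equality
    inv a ℚ.- inv b                                        ≃⟨ ℚ.+-cong (ℚ.*-identityʳ (inv a)) (ℚ.-‿cong (ℚ.*-identityʳ (inv b))) ⟨
    inv a ℚ.* 1ℚᵘ ℚ.- inv b ℚ.* 1ℚᵘ                        ≃⟨ ℚ.+-cong (ℚ.*-congˡ {inv a} (inv-inverse b>0)) (ℚ.-‿cong (ℚ.*-congˡ {inv b} (inv-inverse a>0))) ⟨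
    inv a ℚ.* (b ℚ.* inv b) ℚ.- inv b ℚ.* (a ℚ.* inv a)    ≃⟨ solve 4 (λ a b i j → i :* (b :* j) :- j :* (a :* i) := (b :- a) :* (i :* j)) ℚ.≃-refl a b (inv a) (inv b) ⟩
    (b ℚ.- a) ℚ.* (inv a ℚ.* inv b)                        ∎

_/ᴿ_ : (x y : ℝ) → {{Positive y}} → ℝ
x /ᴿ y = x *ᴿ recip y

instance
  +-positive : ∀ {x m} → {{Positive x}} → Positive (x +ᴿ fromℕ m)
  +-positive {x} {m} {{positive (ε , ε>0 , K , ε≤x)}} = positive (ε , ε>0 , K , λ k K≤k →
    ℚ.≤-trans (ε≤x k K≤k) (ℚ.p≤p+q (approx x k) (+ m ℚ./ 1)))

-- The hypothesis holds for a j = ⌊ (j + 1) x ⌋ with x ≥ 0, and then the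
-- approximations a j / (j + 1) converge to x.
fromNumerators : (a : ℕ → ℕ) → (∀ j k → a j ℕ.* suc k ℕ.≤ suc (a k) ℕ.* suc j) → ℝ
approx (fromNumerators a close) k = + a k ℚ./ suc k
cauchy (fromNumerators a close) (mkℚᵘ (+ 0)      d) ε>0 with () ← ℚ.positive ε>0
cauchy (fromNumerators a close) (mkℚᵘ ℤ.-[1+ _ ] d) ε>0 with () ← ℚ.positive ε>0
cauchy (fromNumerators a close) ε@(mkℚᵘ ℤ.+[1+ m ] d) ε>0 = d , λ j k d≤j d≤k →
  ∣∣-≤ (p-q≤r {+ a j ℚ./ suc j} {+ a k ℚ./ suc k} (one-sided j k d≤k))
       (ℚ.≤-trans (ℚ.≤-reflexive (flip (+ a j ℚ./ suc j) (+ a k ℚ./ suc k))) (p-q≤r {+ a k ℚ./ suc k} {+ a j ℚ./ suc j} (one-sided k j d≤j)))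
  where
  flip : ∀ p q → ℚ.- (p ℚ.- q) ℚ.≃ q ℚ.- p
  flip = solve 2 (λ p q → :- (p :- q) := q :- p) ℚ.≃-refl
    where open ℚ-Solver
  one-sided : ∀ j k → d ℕ.≤ k → + a j ℚ./ suc j ℚ.≤ + a k ℚ./ suc k ℚ.+ ε
  one-sided j k d≤k = begin
    + a j ℚ./ suc j                        ≤⟨ /-≤ (a j) (suc (a k)) j k (close j k) ⟩
    + suc (a k) ℚ./ suc k                  ≃⟨ split ⟩
    + a k ℚ./ suc k ℚ.+ + 1 ℚ./ suc k      ≤⟨ ℚ.+-monoʳ-≤ (+ a k ℚ./ suc k) (/-≤ 1 (suc m) k d (ℕ.*-mono-≤ {1} {suc m} (s≤s z≤n) (s≤s d≤k))) ⟩
    + a k ℚ./ suc k ℚ.+ ε                  ∎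
    where
    open ℚ.≤-Reasoning
    split : + suc (a k) ℚ./ suc k ℚ.≃ + a k ℚ./ suc k ℚ.+ + 1 ℚ./ suc k
    split = ℚ.*≡* (solve 2 (λ A k → (con (+ 1) :+ A) :* (k :* k) := (A :* k :+ con (+ 1) :* k) :* k) refl (+ a k) (+ suc k))
      where
      open ℤ-Solver

2^⌊log₂⌋≤ : ∀ m → NonZero m → 2 ℕ.^ ⌊log₂ m ⌋ ℕ.≤ m
2^⌊log₂⌋≤ = <-rec (λ m → NonZero m → 2 ℕ.^ ⌊log₂ m ⌋ ℕ.≤ m) go
  where
  go : ∀ m → (∀ {k} → k ℕ.< m → NonZero k → 2 ℕ.^ ⌊log₂ k ⌋ ℕ.≤ k) →
       NonZero m → 2 ℕ.^ ⌊log₂ m ⌋ ℕ.≤ m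
  go 1               _   _ = s≤s z≤n
  go m@(suc (suc k)) rec _ = begin
    2 ℕ.^ ⌊log₂ m ⌋                      ≤⟨ ℕ.^-monoʳ-≤ 2 (ℕ.m≤n+m∸n ⌊log₂ m ⌋ 1) ⟩
    2 ℕ.* 2 ℕ.^ (⌊log₂ m ⌋ ∸ 1)          ≡⟨ cong (λ e → 2 ℕ.* 2 ℕ.^ e) (⌊log₂⌊n/2⌋⌋≡⌊log₂n⌋∸1 m) ⟨
    2 ℕ.* 2 ℕ.^ ⌊log₂ ℕ.⌊ m /2⌋ ⌋        ≤⟨ ℕ.*-monoʳ-≤ 2 (rec (ℕ.⌊n/2⌋<n (suc k)) _) ⟩
    2 ℕ.* ℕ.⌊ m /2⌋                      ≡⟨ cong (ℕ.⌊ m /2⌋ ℕ.+_) (ℕ.+-identityʳ ℕ.⌊ m /2⌋) ⟩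
    ℕ.⌊ m /2⌋ ℕ.+ ℕ.⌊ m /2⌋              ≤⟨ ℕ.+-monoʳ-≤ ℕ.⌊ m /2⌋ (ℕ.⌊n/2⌋≤⌈n/2⌉ m) ⟩
    ℕ.⌊ m /2⌋ ℕ.+ ℕ.⌈ m /2⌉              ≡⟨ ℕ.⌊n/2⌋+⌈n/2⌉≡n m ⟩
    m                                    ∎
    where open ℕ.≤-Reasoning

<2^1+⌊log₂⌋ : ∀ m → m ℕ.< 2 ℕ.^ suc ⌊log₂ m ⌋
<2^1+⌊log₂⌋ m with m ℕ.<? 2 ℕ.^ suc ⌊log₂ m ⌋
... | yes m<  = m<
... | no ¬m<  = contradiction
  (subst (ℕ._≤ ⌊log₂ m ⌋) (⌊log₂[2^n]⌋≡n (suc ⌊log₂ m ⌋)) (⌊log₂⌋-mono-≤ (ℕ.≮⇒≥ ¬m<)))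
  ℕ.1+n≰n

log-close : ∀ n .{{_ : NonZero n}} j k →
            ⌊log₂ n ℕ.^ suc j ⌋ ℕ.* suc k ℕ.≤ suc ⌊log₂ n ℕ.^ suc k ⌋ ℕ.* suc j
log-close n j k = ℕ.≮⇒≥ λ gt → ℕ.<-irrefl refl (begin-strict
  2 ℕ.^ (suc (a k) ℕ.* suc j)          ≤⟨ ℕ.^-monoʳ-≤ 2 (ℕ.<⇒≤ gt) ⟩
  2 ℕ.^ (a j ℕ.* suc k)                ≡⟨ ℕ.^-*-assoc 2 (a j) (suc k) ⟨
  (2 ℕ.^ a j) ℕ.^ suc k                ≤⟨ ℕ.^-monoˡ-≤ (suc k) (2^⌊log₂⌋≤ (n ℕ.^ suc j) (ℕ.m^n≢0 n (suc j))) ⟩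
  (n ℕ.^ suc j) ℕ.^ suc k              ≡⟨ trans (ℕ.^-*-assoc n (suc j) (suc k)) (trans (cong (n ℕ.^_) (ℕ.*-comm (suc j) (suc k))) (sym (ℕ.^-*-assoc n (suc k) (suc j)))) ⟩
  (n ℕ.^ suc k) ℕ.^ suc j              <⟨ ℕ.^-monoˡ-< (suc j) (<2^1+⌊log₂⌋ (n ℕ.^ suc k)) ⟩
  (2 ℕ.^ suc (a k)) ℕ.^ suc j          ≡⟨ ℕ.^-*-assoc 2 (suc (a k)) (suc j) ⟩
  2 ℕ.^ (suc (a k) ℕ.* suc j)          ∎)
  where
  open ℕ.≤-Reasoning
  a : ℕ → ℕ
  a k = ⌊log₂ n ℕ.^ suc k ⌋

-- Uses ⌊ (k + 1) log₂ n ⌋ = ⌊ log₂ (n ^ (k + 1)) ⌋.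
log₂ : (n : ℕ) → .{{NonZero n}} → ℝ
log₂ n = fromNumerators (λ k → ⌊log₂ n ℕ.^ suc k ⌋) (log-close n)

instance
  log₂-positive : ∀ {n} .{{_ : NonTrivial n}} → Positive (log₂ n {{ℕ.nonTrivial⇒nonZero n}})
  log₂-positive {n} = positive (1ℚᵘ , 0<1 , 0 , λ k _ →
    /-≤ 1 ⌊log₂ n ℕ.^ suc k ⌋ 0 k (bound k))
    where
    bound : ∀ k → 1 ℕ.* suc k ℕ.≤ ⌊log₂ n ℕ.^ suc k ⌋ ℕ.* 1
    bound k = subst₂ ℕ._≤_
      (trans (⌊log₂[2^n]⌋≡n (suc k)) (sym (ℕ.*-identityˡ (suc k)))) (sym (ℕ.*-identityʳ _))
      (⌊log₂⌋-mono-≤ (ℕ.^-monoˡ-≤ (suc k) (ℕ.nonTrivial⇒n>1 n)))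

greatest : {P : ℕ → Set} → (∀ j → Dec (P j)) → ℕ → ℕ
greatest P? zero = zero
greatest P? (suc b) with P? (suc b)
... | yes _ = suc b
... | no _  = greatest P? b

greatest-holds : {P : ℕ → Set} (P? : ∀ j → Dec (P j)) → P 0 → ∀ b → P (greatest P? b)
greatest-holds P? p₀ zero = p₀
greatest-holds P? p₀ (suc b) with P? (suc b)
... | yes p = p
... | no _  = greatest-holds P? p₀ b

greatest-is-greatest : {P : ℕ → Set} (P? : ∀ j → Dec (P j)) → ∀ b j → j ℕ.≤ b → P j → j ℕ.≤ greatest P? b
greatest-is-greatest P? zero    j j≤b _ = j≤b
greatest-is-greatest P? (suc b) j j≤b p with P? (suc b)
... | yes _ = j≤b
... | no ¬p with ℕ.m≤n⇒m<n∨m≡n j≤b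
...   | inj₁ (s≤s j≤b′) = greatest-is-greatest P? b j j≤b′ p
...   | inj₂ refl       = contradiction p ¬p

-- ⌊ (k + 1) √(p/q) ⌋, the greatest j with j² q ≤ p (k + 1)²
sqrtNumerator : (p q k : ℕ) → ℕ
sqrtNumerator p q k = greatest (λ j → (j ℕ.* j) ℕ.* q ℕ.≤? p ℕ.* (suc k ℕ.* suc k)) (p ℕ.* (suc k ℕ.* suc k))

sqrt-lower : ∀ p q k → (sqrtNumerator p q k ℕ.* sqrtNumerator p q k) ℕ.* q ℕ.≤ p ℕ.* (suc k ℕ.* suc k)
sqrt-lower p q k = greatest-holds (λ j → (j ℕ.* j) ℕ.* q ℕ.≤? p ℕ.* (suc k ℕ.* suc k)) z≤n (p ℕ.* (suc k ℕ.* suc k))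

sqrt-upper : ∀ p q .{{_ : NonZero q}} k → let j = suc (sqrtNumerator p q k) in
             p ℕ.* (suc k ℕ.* suc k) ℕ.< (j ℕ.* j) ℕ.* q
sqrt-upper p q k with (suc (sqrtNumerator p q k) ℕ.* suc (sqrtNumerator p q k)) ℕ.* q ℕ.≤? p ℕ.* (suc k ℕ.* suc k)
... | no ¬≤ = ℕ.≰⇒> ¬≤
... | yes ≤ = contradiction
  (greatest-is-greatest (λ j → (j ℕ.* j) ℕ.* q ℕ.≤? p ℕ.* (suc k ℕ.* suc k)) (p ℕ.* (suc k ℕ.* suc k)) (suc r)
    (ℕ.≤-trans (ℕ.m≤m*n (suc r) (suc r)) (ℕ.≤-trans (ℕ.m≤m*n (suc r ℕ.* suc r) q) ≤)) ≤)
  ℕ.1+n≰n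
  where r = sqrtNumerator p q k

sqrt-close : ∀ p q .{{_ : NonZero q}} j k →
             sqrtNumerator p q j ℕ.* suc k ℕ.≤ suc (sqrtNumerator p q k) ℕ.* suc j
sqrt-close p q j k = ℕ.≮⇒≥ λ gt → ℕ.<-irrefl refl (begin-strict
  (v ℕ.* suc j) ℕ.* (v ℕ.* suc j) ℕ.* q              ≤⟨ ℕ.*-monoˡ-≤ q (ℕ.*-mono-≤ (ℕ.<⇒≤ gt) (ℕ.<⇒≤ gt)) ⟩
  (u ℕ.* suc k) ℕ.* (u ℕ.* suc k) ℕ.* q              ≡⟨ solve 3 (λ u k q → (u :* k) :* (u :* k) :* q := (u :* u) :* q :* (k :* k)) refl u (suc k) q ⟩
  (u ℕ.* u) ℕ.* q ℕ.* (suc k ℕ.* suc k)              ≤⟨ ℕ.*-monoˡ-≤ (suc k ℕ.* suc k) (sqrt-lower p q j) ⟩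
  p ℕ.* (suc j ℕ.* suc j) ℕ.* (suc k ℕ.* suc k)      ≡⟨ solve 3 (λ p j k → p :* (j :* j) :* (k :* k) := p :* (k :* k) :* (j :* j)) refl p (suc j) (suc k) ⟩
  p ℕ.* (suc k ℕ.* suc k) ℕ.* (suc j ℕ.* suc j)      <⟨ ℕ.*-monoˡ-< (suc j ℕ.* suc j) (sqrt-upper p q k) ⟩
  (v ℕ.* v) ℕ.* q ℕ.* (suc j ℕ.* suc j)              ≡⟨ solve 3 (λ v j q → (v :* v) :* q :* (j :* j) := (v :* j) :* (v :* j) :* q) refl v (suc j) q ⟩
  (v ℕ.* suc j) ℕ.* (v ℕ.* suc j) ℕ.* q              ∎)
  where
  open ℕ.≤-Reasoning
  open ℕ-Solver
  u = sqrtNumerator p q j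
  v = suc (sqrtNumerator p q k)

√[_/_] : (p q : ℕ) → .{{NonZero q}} → ℝ
√[ p / q ] = fromNumerators (sqrtNumerator p q) (sqrt-close p q)

{-# OPTIONS --safe #-}
module Submission where

-- Cut the columns into blocks of width w = q + 1, where ℓ = ⌊log₂ n⌋ and q = ⌊ℓ/2⌋, and
-- interpose between pixels and lines the ensemble of windows, the intersections of a
-- line with a block.  As slopes lie in [0, 1], a line rises by 0 or 1 from each column
-- to the next, so a window is determined by its block, its first height and q bits: with
-- b = ⌈n/w⌉ blocks there are at most b n 2^q windows, each costing at most q, and each
-- of the at most n² lines costs at most b - 1.  Multiplied by ℓ + 2, the total
-- b n 2^q q + n² (b - 1) is still below 4 n³, while 4 n³ / (ℓ + 2) is at most the
-- claimed bound even without its square root, because L = log₂ n ≤ ℓ + 1 and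
-- (1 - 1/(L + 1)) / L = 1/(L + 1).  The depth is at most q + ℓ + 1 ≤ ℓ (ℓ + 1).
-- The windows lie inside the lines, so the chain can start from the support of the
-- ensemble as well as from all the pixels.

open import Data.Fin.Base using (Fin; zero; suc; toℕ; fromℕ<; combine; remQuot; funToFin; finToFun)
import Data.Fin.Properties as Fin
open import Data.Fin.Subset using (Subset; Nonempty; ⁅_⁆; ⋃; _∩_)
  renaming (_∈_ to _∈ₛ_; _⊆_ to _⊆ₛ_)
import Data.Fin.Subset.Properties as Sub
open import Data.Integer.Base as ℤ using (+_)
import Data.Integer.DivMod as ℤ
import Data.Integer.Properties as ℤ
open import Data.List.Base using (List; []; _∷_; map; filter; length; allFin; cartesianProductWith; deduplicate)
open import Data.List.Extrema.Nat using (max≤v⁺)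
open import Data.List.Membership.Propositional using (_∈_)
open import Data.List.Membership.Propositional.Properties
  using (∈-lookup; ∈-filter⁺; ∈-filter⁻; ∈-allFin; ∈-map⁺; ∈-map⁻;
         ∈-cartesianProductWith⁺; ∈-cartesianProductWith⁻; ∈-deduplicate⁺; ∈-deduplicate⁻)
open import Data.List.Relation.Binary.Sublist.Propositional using (_⊆_)
import Data.List.Relation.Binary.Sublist.Propositional.Properties as Sublist
open import Data.List.Relation.Unary.All as All using (All; []; _∷_)
import Data.List.Relation.Unary.All.Properties as All
open import Data.List.Relation.Unary.AllPairs using (AllPairs; []; _∷_)
open import Data.List.Relation.Unary.Any using (here; there)
open import Data.List.Relation.Unary.Any.Properties using (¬Any[])
open import Data.List.Relation.Unary.Unique.Propositional using (Unique)
import Data.List.Relation.Unary.Unique.Propositional.Properties as Unique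
import Data.List.Relation.Unary.Unique.DecPropositional.Properties as Unique
open import Data.Nat.Base
  using (ℕ; zero; suc; NonZero; NonTrivial; >-nonZero; >-nonZero⁻¹; ≢-nonZero; ≢-nonZero⁻¹;
         nonTrivial⇒nonZero; nonTrivial⇒n>1; _+_; _*_; _^_; _∸_; _/_; _%_; _≤_; _<_; z≤n; s≤s; s≤s⁻¹)
open import Data.Nat.DivMod
open import Data.Nat.ListAction using (sum)
open import Data.Nat.Logarithm using (⌈log₂_⌉; ⌊log₂_⌋; ⌈log₂⌉-mono-≤; ⌈log₂2^n⌉≡n; ⌊log₂⌋-mono-≤; ⌊log₂[2^n]⌋≡n)
import Data.Nat.Properties as ℕ
open import Data.Product.Base using (Σ-syntax; ∃-syntax; _×_; _,_; proj₁; proj₂)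
open import Data.Rational.Unnormalised.Base as ℚ using (0ℚᵘ; 1ℚᵘ)
import Data.Rational.Unnormalised.Properties as ℚ
open import Data.Rational.Unnormalised.Solver using () renaming (module +-*-Solver to ℚ-Solver)
open import Data.Integer.Solver using () renaming (module +-*-Solver to ℤ-Solver)
open import Data.Nat.Solver using () renaming (module +-*-Solver to ℕ-Solver)
open import Data.Sum.Base using (_⊎_; inj₁; inj₂)
import Data.Vec.Base as Vec
import Data.Vec.Properties as Vec
open import Function.Base using (_∘_)
open import Relation.Binary.PropositionalEquality
  using (_≡_; _≢_; refl; sym; trans; cong; cong₂; subst; subst₂; module ≡-Reasoning)
open import Relation.Nullary using (Dec; yes; does; contradiction)
open import Relation.Nullary.Decidable using (dec-true)
open import Defs

-- Counting and membership in finite sets.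

-- Choosing a code for each position gives an injection into `Fin K`: positions with a common code
-- hold equal entries, hence coincide. `R` is a relation because one entry may have several codes.
unique⇒length≤ : ∀ {A : Set} {K} {xs : List A} → Unique xs → (R : A → Fin K → Set) →
                 (∀ {x} → x ∈ xs → ∃[ c ] R x c) → (∀ {x y c} → R x c → R y c → x ≡ y) →
                 length xs ≤ K
unique⇒length≤ {xs = xs} u R code inj =
  Fin.injective⇒≤ {f = λ i → proj₁ (code (∈-lookup {xs = xs} i))} λ {i} {j} eq →
    lookup-inj u i j
      (inj (proj₂ (code (∈-lookup i))) (subst (R _) (sym eq) (proj₂ (code (∈-lookup j)))))

unique⇒allPairs : ∀ {A : Set} {R : A → A → Set} {xs : List A} → Unique xs →
                  (∀ {x y} → x ∈ xs → y ∈ xs → x ≢ y → R x y) → AllPairs R xs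
unique⇒allPairs []       _ = []
unique⇒allPairs (x∉ ∷ u) r =
  All.tabulate (λ y∈ → r (here refl) (there y∈) (All.lookup x∉ y∈)) ∷
  unique⇒allPairs u (λ x∈ y∈ → r (there x∈) (there y∈))

sum-map-≤ : ∀ {A : Set} (f : A → ℕ) {b} xs → (∀ {x} → x ∈ xs → f x ≤ b) → sum (map f xs) ≤ length xs * b
sum-map-≤ f []       _  = z≤n
sum-map-≤ f (x ∷ xs) f≤ = ℕ.+-mono-≤ (f≤ (here refl)) (sum-map-≤ f xs (f≤ ∘ there))

comprehension : ∀ {N} {P : Fin N → Set} → (∀ x → Dec (P x)) → Subset N
comprehension P? = Vec.tabulate (does ∘ P?)

∈-comprehension⁺ : ∀ {N} {P : Fin N → Set} (P? : ∀ x → Dec (P x)) {x} → P x → x ∈ₛ comprehension P?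
∈-comprehension⁺ P? {x} p =
  Vec.lookup⇒[]= x _ (trans (Vec.lookup∘tabulate (does ∘ P?) x) (dec-true (P? x) p))

∈-comprehension⁻ : ∀ {N} {P : Fin N → Set} (P? : ∀ x → Dec (P x)) {x} → x ∈ₛ comprehension P? → P x
∈-comprehension⁻ P? {x} x∈
  with P? x | trans (sym (Vec.lookup∘tabulate (does ∘ P?) x)) (Vec.[]=⇒lookup x∈)
... | yes p | _ = p

∈-image⁺ : ∀ {M N} (g : Fin M → Fin N) {P x} → x ∈ₛ P → g x ∈ₛ image g P
∈-image⁺ g {x = x} x∈P = ∈-⋃⁺ (∈-map⁺ (⁅_⁆ ∘ g) (∈-elements⁺ x∈P)) (Sub.x∈⁅x⁆ (g x))

∈-image⁻ : ∀ {M N} (g : Fin M → Fin N) P {y} → y ∈ₛ image g P → ∃[ x ] x ∈ₛ P × y ≡ g x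
∈-image⁻ g P y∈ with ∈-⋃⁻ (map (⁅_⁆ ∘ g) (elements P)) y∈
... | Q , Q∈ , y∈Q with ∈-map⁻ (⁅_⁆ ∘ g) Q∈
...   | x , x∈ , refl = x , ∈-elements⁻ P x∈ , Sub.x∈⁅y⁆⇒x≡y (g x) y∈Q

-- Partitions into given pieces and bounds on their cost.

module _ {N K} (𝒜 : Ensemble N) {B} (piece : Fin K → Subset N)
  (piece∈𝒜 : ∀ j → piece j ∈ patterns 𝒜)
  (disjoint : ∀ {i j} → i ≢ j → Disjoint (piece i) (piece j))
  (B⊆ : ∀ {x} → x ∈ₛ B → ∃[ j ] x ∈ₛ piece j) (⊆B : ∀ j → piece j ⊆ₛ B) where

  -- Filtering `patterns 𝒜`, instead of listing the pieces, yields a sublist in the required order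
  -- and without repetition. Distinct members come from distinct indices, hence are disjoint, and
  -- the indices count them.
  pieces-partition : ∃[ σ ] σ ⊆ patterns 𝒜 × σ PartitionOf B × length σ ≤ K
  pieces-partition = σ , Sublist.filter-⊆ piece? (patterns 𝒜) ,
    (unique⇒allPairs σ-unique apart , Sub.⊆-antisym fwd bwd) ,
    unique⇒length≤ σ-unique (λ P j → P ≡ piece j) ∈σ⁻ (λ p q → trans p (sym q))
    where
    piece? : ∀ P → Dec (∃[ j ] P ≡ piece j)
    piece? P = Fin.any? λ j → P ≟ₛ piece j
    σ = filter piece? (patterns 𝒜)
    σ-unique : Unique σ
    σ-unique = Unique.filter⁺ piece? (unique 𝒜)
    ∈σ⁻ : ∀ {P} → P ∈ σ → ∃[ j ] P ≡ piece j
    ∈σ⁻ P∈ = proj₂ (∈-filter⁻ piece? {xs = patterns 𝒜} P∈)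
    apart : ∀ {P Q} → P ∈ σ → Q ∈ σ → P ≢ Q → Disjoint P Q
    apart P∈ Q∈ P≢Q with ∈σ⁻ P∈ | ∈σ⁻ Q∈
    ... | i , refl | j , refl = disjoint (P≢Q ∘ cong piece)
    fwd : ⋃ σ ⊆ₛ B
    fwd x∈ with ∈-⋃⁻ σ x∈
    ... | P , P∈ , x∈P with ∈σ⁻ P∈
    ...   | j , refl = ⊆B j x∈P
    bwd : B ⊆ₛ ⋃ σ
    bwd x∈B with B⊆ x∈B
    ... | j , x∈ = ∈-⋃⁺ (∈-filter⁺ piece? (piece∈𝒜 j) (j , refl)) x∈

ω-≤ : ∀ {N} (𝒜 : Ensemble N) {B σ K} → σ ⊆ patterns 𝒜 → σ PartitionOf B → length σ ≤ suc K → ω 𝒜 B ≤ K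
ω-≤ 𝒜 σ⊆ part len = ℕ.∸-monoˡ-≤ 1 (ℕ.≤-trans (leastSize-≤ 𝒜 σ⊆ part) len)

-- On the one-pattern ensemble {B}, the decomposition chosen by singletons-▷ is seen by
-- computation to be map ⁅_⁆ (elements B).
ω-singletons-≤ : ∀ {N P} ne {B : Subset N} {K} → Nonempty B → B ⊆ₛ P → length (elements B) ≤ suc K →
                 ω (singletons P ne) B ≤ K
ω-singletons-≤ {P = P} ne {B} B-ne B⊆P len
  with singletons-▷ {P = P} ne
         (record { patterns = B ∷ [] ; unique = [] ∷ [] ; nonempty = λ () ; patternNonempty = B-ne ∷ [] })
         (λ { (here refl) → B⊆P }) in eq
... | (σ , σ⊆ , part) ∷ [] with refl ← cong (proj₁ ∘ All.head) eq =
  ω-≤ (singletons P ne) σ⊆ part (ℕ.≤-trans (ℕ.≤-reflexive (length-map ⁅_⁆ (elements B))) len)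
  where open import Data.List.Properties using (length-map)

stepDepth-≤ : ∀ {N} (𝒜 ℬ : Ensemble N) {K} → (∀ {B} → B ∈ patterns ℬ → ω 𝒜 B ≤ K) →
              stepDepth 𝒜 ℬ ≤ ⌈log₂ suc K ⌉
stepDepth-≤ 𝒜 ℬ {K} ω≤ = max≤v⁺ z≤n (All.map⁺ (All.tabulate λ B∈ →
  ⌈log₂⌉-mono-≤ (ℕ.≤-trans (ℕ.+-monoˡ-≤ 1 (ω≤ B∈)) (ℕ.≤-reflexive (ℕ.+-comm K 1)))))

-- Lines as height functions on the natural numbers.

-- Adding 1/2 to ab/(k + 1) gives (2ab + k + 1)/(2(k + 1)), whose floor is a quotient of natural
-- numbers.
[a/k*b] : ∀ a b k → [ (+ a ℚ./ suc k) ℚ.* (+ b ℚ./ 1) ] ≡ + ((a * b * 2 + suc k) / (suc k * 2))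
[a/k*b] a b k rewrite ℕ.*-identityʳ k =
  trans (ℤ.div-pos-is-/ℕ num (suc k * 2)) (cong (ℤ._/ℕ (suc k * 2)) num≡)
  where
  num = + a ℤ.* + b ℤ.* + 2 ℤ.+ + 1 ℤ.* + suc k
  num≡ : num ≡ + (a * b * 2 + suc k)
  num≡ = cong₂ ℤ._+_ (trans (cong (ℤ._* + 2) (sym (ℤ.pos-* a b))) (sym (ℤ.pos-* (a * b) 2)))
                     (ℤ.*-identityˡ (+ suc k))

toℕ-baseFunction : ∀ n .{{_ : NonTrivial n}} .{{_ : NonZero n}} .{{_ : NonZero ((n ∸ 1) * 2)}} e x →
                   toℕ (baseFunction n e x) ≡ (toℕ e * toℕ x * 2 + (n ∸ 1)) / ((n ∸ 1) * 2) % n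
toℕ-baseFunction (suc (suc m)) e x =
  trans (Fin.toℕ-fromℕ< _) (cong (ℤ._%ℕ suc (suc m)) ([a/k*b] (toℕ e) (toℕ x) m))

module _ (n : ℕ) .{{_ : NonTrivial n}} where

  private
    instance
      n≢0 : NonZero n
      n≢0 = nonTrivial⇒nonZero n

      n-1≢0 : NonZero (n ∸ 1)
      n-1≢0 = >-nonZero (ℕ.m<n⇒0<n∸m (nonTrivial⇒n>1 n))

      [n-1]*2≢0 : NonZero ((n ∸ 1) * 2)
      [n-1]*2≢0 = ℕ.m*n≢0 (n ∸ 1) 2

    %-cong-+ˡ : ∀ c {a b} → a % n ≡ b % n → (c + a) % n ≡ (c + b) % n
    %-cong-+ˡ c {a} {b} eq = begin
      (c + a) % n              ≡⟨ %-distribˡ-+ c a n ⟩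
      (c % n + a % n) % n      ≡⟨ cong (λ r → (c % n + r) % n) eq ⟩
      (c % n + b % n) % n      ≡⟨ %-distribˡ-+ c b n ⟨
      (c + b) % n              ∎
      where open ≡-Reasoning

  -- [ e x / (n - 1) ]; unlike baseFunction, not reduced modulo n and defined for
  -- columns beyond the image as well.
  height : ℕ → ℕ → ℕ
  height e x = (e * x * 2 + (n ∸ 1)) / ((n ∸ 1) * 2)

  height-≤-suc : ∀ e x → height e x ≤ height e (suc x)
  height-≤-suc e x = /-monoˡ-≤ ((n ∸ 1) * 2)
    (ℕ.+-monoˡ-≤ (n ∸ 1) (ℕ.*-monoˡ-≤ 2 (ℕ.*-monoʳ-≤ e (ℕ.n≤1+n x))))

  -- One column further the numerator has grown by 2e, which is at most the denominator 2(n - 1).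
  height-suc-≤ : ∀ {e} x → e ≤ n ∸ 1 → height e (suc x) ≤ suc (height e x)
  height-suc-≤ {e} x e≤ = begin
    (e * suc x * 2 + k) / (k * 2)          ≡⟨ cong (λ t → (t * 2 + k) / (k * 2)) (ℕ.*-suc e x) ⟩
    ((e + e * x) * 2 + k) / (k * 2)        ≡⟨ cong (λ t → (t + k) / (k * 2)) (ℕ.*-distribʳ-+ 2 e (e * x)) ⟩
    (e * 2 + e * x * 2 + k) / (k * 2)      ≡⟨ cong (_/ (k * 2)) (ℕ.+-assoc (e * 2) (e * x * 2) k) ⟩
    (e * 2 + (e * x * 2 + k)) / (k * 2)    ≤⟨ /-monoˡ-≤ (k * 2) (ℕ.+-monoˡ-≤ (e * x * 2 + k) (ℕ.*-monoˡ-≤ 2 e≤)) ⟩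
    (k * 2 + (e * x * 2 + k)) / (k * 2)    ≡⟨ +-distrib-/-∣ˡ (e * x * 2 + k) (∣-refl {k * 2}) ⟩
    k * 2 / (k * 2) + height e x           ≡⟨ cong (_+ height e x) (n/n≡1 (k * 2)) ⟩
    suc (height e x)                       ∎
    where
    open ℕ.≤-Reasoning
    open import Data.Nat.Divisibility using (∣-refl)
    k = n ∸ 1

  -- Valued in `Fin 2` so that q consecutive rises pack into one element of `Fin (2 ^ q)`.
  rise : Fin n → ℕ → Fin 2
  rise e x = fromℕ< {height (toℕ e) (suc x) ∸ height (toℕ e) x}
    (s≤s (ℕ.m≤n+o⇒m∸n≤o (height (toℕ e) (suc x)) (height (toℕ e) x) (ℕ.≤-trans (height-suc-≤ x (Fin.toℕ≤pred[n] e))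
      (ℕ.≤-reflexive (ℕ.+-comm 1 (height (toℕ e) x))))))

  rise+height : ∀ e x → toℕ (rise e x) + height (toℕ e) x ≡ height (toℕ e) (suc x)
  rise+height e x = trans (cong (_+ height (toℕ e) x) (Fin.toℕ-fromℕ< _)) (ℕ.m∸n+n≡m (height-≤-suc (toℕ e) x))

  line : Fin n → Fin n → Fin n → Fin n
  line e s x = modₙ n (+ toℕ (baseFunction n e x) ℤ.+ + toℕ s)

  lineHeight : Fin n → Fin n → ℕ → ℕ
  lineHeight e s x = (height (toℕ e) x + toℕ s) % n

  toℕ-line : ∀ e s x → toℕ (line e s x) ≡ lineHeight e s (toℕ x)
  toℕ-line e s x = begin
    toℕ (line e s x)                                  ≡⟨ Fin.toℕ-fromℕ< _ ⟩
    (toℕ (baseFunction n e x) + toℕ s) % n            ≡⟨ cong (_% n) (ℕ.+-comm (toℕ (baseFunction n e x)) (toℕ s)) ⟩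
    (toℕ s + toℕ (baseFunction n e x)) % n            ≡⟨ cong (λ y → (toℕ s + y) % n) (toℕ-baseFunction n e x) ⟩
    (toℕ s + height (toℕ e) (toℕ x) % n) % n          ≡⟨ %-cong-+ˡ (toℕ s) (m%n%n≡m%n (height (toℕ e) (toℕ x)) n) ⟩
    (toℕ s + height (toℕ e) (toℕ x)) % n              ≡⟨ cong (_% n) (ℕ.+-comm (toℕ s) (height (toℕ e) (toℕ x))) ⟩
    lineHeight e s (toℕ x)                            ∎
    where open ≡-Reasoning

  lineHeight-suc : ∀ e s x → lineHeight e s (suc x) ≡ (toℕ (rise e x) + (height (toℕ e) x + toℕ s)) % n
  lineHeight-suc e s x = cong (_% n) (trans (cong (_+ toℕ s) (sym (rise+height e x)))
    (ℕ.+-assoc (toℕ (rise e x)) (height (toℕ e) x) (toℕ s)))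

  -- Induction on the offset: adding the same rise to both sides preserves equality modulo n. The
  -- slopes and shifts themselves may differ.
  lineHeight-determined : ∀ e s e′ s′ x q → lineHeight e s x ≡ lineHeight e′ s′ x →
    (∀ (i : Fin q) → rise e (x + toℕ i) ≡ rise e′ (x + toℕ i)) →
    ∀ i → i ≤ q → lineHeight e s (x + i) ≡ lineHeight e′ s′ (x + i)
  lineHeight-determined e s e′ s′ x q start rises zero _ =
    subst (λ z → lineHeight e s z ≡ lineHeight e′ s′ z) (sym (ℕ.+-identityʳ x)) start
  lineHeight-determined e s e′ s′ x q start rises (suc i) i<q =
    subst (λ z → lineHeight e s z ≡ lineHeight e′ s′ z) (sym (ℕ.+-suc x i)) (begin
    lineHeight e s (suc (x + i))                                        ≡⟨ lineHeight-suc e s (x + i) ⟩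
    (toℕ (rise e (x + i)) + (height (toℕ e) (x + i) + toℕ s)) % n       ≡⟨ %-cong-+ˡ (toℕ (rise e (x + i))) (lineHeight-determined e s e′ s′ x q start rises i (ℕ.<⇒≤ i<q)) ⟩
    (toℕ (rise e (x + i)) + (height (toℕ e′) (x + i) + toℕ s′)) % n     ≡⟨ cong (λ r → (toℕ r + (height (toℕ e′) (x + i) + toℕ s′)) % n) same-rise ⟩
    (toℕ (rise e′ (x + i)) + (height (toℕ e′) (x + i) + toℕ s′)) % n    ≡⟨ lineHeight-suc e′ s′ (x + i) ⟨
    lineHeight e′ s′ (suc (x + i))                                      ∎)
    where
    open ≡-Reasoning
    same-rise : rise e (x + i) ≡ rise e′ (x + i)
    same-rise = subst (λ k → rise e (x + k) ≡ rise e′ (x + k)) (Fin.toℕ-fromℕ< i<q) (rises (fromℕ< i<q))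

  column row : Fin (n * n) → Fin n
  column p = proj₁ (remQuot {n} n p)
  row    p = proj₂ (remQuot {n} n p)

  column-combine : ∀ (x y : Fin n) → column (combine x y) ≡ x
  column-combine x y = cong proj₁ (Fin.remQuot-combine x y)

  row-combine : ∀ (x y : Fin n) → row (combine x y) ≡ y
  row-combine x y = cong proj₂ (Fin.remQuot-combine x y)

  shift-hat : ∀ e s x → shift n (+ toℕ s) (hat n (baseFunction n e) x) ≡ combine x (line e s x)
  shift-hat e s x = cong (λ (x , y) → combine x (modₙ n (+ toℕ y ℤ.+ + toℕ s)))
    (Fin.remQuot-combine x (baseFunction n e x))

  on-line : ∀ e s x → row (combine x (line e s x)) ≡ line e s (column (combine x (line e s x)))
  on-line e s x = trans (row-combine x (line e s x)) (cong (line e s) (sym (column-combine x (line e s x))))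

  -- With the converse below, this makes a Hough pattern the graph of `line e s`, so that membership
  -- becomes an equation between rows.
  ∈-houghPattern⁻ : ∀ {e s p} → p ∈ₛ houghPattern n e s → row p ≡ line e s (column p)
  ∈-houghPattern⁻ {e} {s} p∈ with ∈-image⁻ (shift n (+ toℕ s)) _ p∈
  ... | _ , r∈ , refl with ∈-image⁻ (hat n (baseFunction n e)) _ r∈
  ...   | x , _ , refl = subst (λ p → row p ≡ line e s (column p)) (sym (shift-hat e s x)) (on-line e s x)

  ∈-houghPattern⁺ : ∀ {e s p} → row p ≡ line e s (column p) → p ∈ₛ houghPattern n e s
  ∈-houghPattern⁺ {e} {s} {p} eq = subst (_∈ₛ houghPattern n e s)
    (trans (shift-hat e s (column p)) (trans (cong (combine (column p)) (sym eq)) (Fin.combine-remQuot {n} n p)))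
    (∈-image⁺ (shift n (+ toℕ s)) (∈-image⁺ (hat n (baseFunction n e)) Sub.∈⊤))

  ∈-houghEnsemble⁻ : ∀ {B} → B ∈ patterns (houghEnsemble n) → ∃[ e ] ∃[ s ] B ≡ houghPattern n e s
  ∈-houghEnsemble⁻ B∈
    with ∈-cartesianProductWith⁻ (houghPattern n) (allFin n) (allFin n)
           (∈-deduplicate⁻ _≟ₛ_ (houghPatterns n) B∈)
  ... | e , s , _ , _ , eq = e , s , eq

  houghEnsemble-size : length (patterns (houghEnsemble n)) ≤ n * n
  houghEnsemble-size = unique⇒length≤ (unique (houghEnsemble n))
    -- `column` and `row` serve here only to decode the pair (e, s) from an element of
    -- `Fin (n * n)`; no pixel is meant.
    (λ B c → B ≡ houghPattern n (column c) (row c))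
    (λ B∈ → let (e , s , eq) = ∈-houghEnsemble⁻ B∈ in
       combine e s , trans eq (cong₂ (houghPattern n) (sym (column-combine e s)) (sym (row-combine e s))))
    (λ p q → trans p (sym q))

  module Windows (q : ℕ) where

    -- The block of column n - 1. Hence `suc lastBlock` is n/(q + 1) rounded up, and `lastBlock` is
    -- the number of unions that join the windows of one line.
    lastBlock : ℕ
    lastBlock = (n ∸ 1) / suc q

    inBlock? : ∀ (j : Fin (suc lastBlock)) p → Dec (toℕ (column p) / suc q ≡ toℕ j)
    inBlock? j p = toℕ (column p) / suc q ℕ.≟ toℕ j

    block : Fin (suc lastBlock) → Subset (n * n)
    block j = comprehension (inBlock? j)

    blockOf : Fin (n * n) → Fin (suc lastBlock)
    blockOf p = fromℕ< {toℕ (column p) / suc q} (s≤s (/-monoˡ-≤ (suc q) (Fin.toℕ≤pred[n] (column p))))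

    ∈-blockOf : ∀ p → p ∈ₛ block (blockOf p)
    ∈-blockOf p = ∈-comprehension⁺ (inBlock? (blockOf p)) {p} (sym (Fin.toℕ-fromℕ< _))

    ∈-block-column : ∀ {j p} → p ∈ₛ block j → toℕ (column p) ≡ toℕ j * suc q + toℕ (column p) % suc q
    ∈-block-column {j} {p} p∈ = begin
      x                              ≡⟨ m≡m%n+[m/n]*n x (suc q) ⟩
      x % suc q + x / suc q * suc q  ≡⟨ ℕ.+-comm (x % suc q) _ ⟩
      x / suc q * suc q + x % suc q  ≡⟨ cong (λ b → b * suc q + x % suc q) (∈-comprehension⁻ (inBlock? j) {p} p∈) ⟩
      toℕ j * suc q + x % suc q      ∎
      where
      open ≡-Reasoning
      x = toℕ (column p)

    block-disjoint : ∀ {i j P} → i ≢ j → Disjoint (P ∩ block i) (P ∩ block j)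
    block-disjoint {i} {j} {P} i≢j (p , p∈) =
      let (p∈i , p∈j) = Sub.x∈p∩q⁻ (P ∩ block i) (P ∩ block j) p∈ in
      i≢j (Fin.toℕ-injective (trans
        (sym (∈-comprehension⁻ (inBlock? i) (proj₂ (Sub.x∈p∩q⁻ P (block i) p∈i))))
        (∈-comprehension⁻ (inBlock? j) (proj₂ (Sub.x∈p∩q⁻ P (block j) p∈j)))))

    window : Fin (suc lastBlock) → Fin n → Fin n → Subset (n * n)
    window j e s = houghPattern n e s ∩ block j

    -- The first column j(q + 1) of the block lies within the image because j ≤ `lastBlock`, and a
    -- line meets every column.
    window-nonempty : ∀ j e s → Nonempty (window j e s)
    window-nonempty j e s = p , Sub.x∈p∩q⁺ (∈-houghPattern⁺ (on-line e s x) , ∈-comprehension⁺ (inBlock? j) {p} p∈)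
      where
      open ℕ.≤-Reasoning
      start<n : toℕ j * suc q < n
      start<n = begin-strict
        toℕ j * suc q          ≤⟨ ℕ.*-monoˡ-≤ (suc q) (Fin.toℕ≤pred[n] j) ⟩
        lastBlock * suc q      ≤⟨ m/n*n≤m (n ∸ 1) (suc q) ⟩
        n ∸ 1                  <⟨ ℕ.n<1+n (n ∸ 1) ⟩
        suc (n ∸ 1)            ≡⟨ ℕ.suc-pred n ⟩
        n                      ∎
      x = fromℕ< start<n
      p = combine x (line e s x)
      p∈ : toℕ (column p) / suc q ≡ toℕ j
      p∈ = trans (cong (λ x → toℕ x / suc q) (column-combine x (line e s x)))
             (trans (cong (_/ suc q) (Fin.toℕ-fromℕ< start<n)) (m*n/n≡m (toℕ j) (suc q)))

    -- The residue of the column modulo q + 1 identifies a pixel: the block supplies the quotient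
    -- and the line supplies the row.
    window-size : ∀ j e s → length (elements (window j e s)) ≤ suc q
    window-size j e s = unique⇒length≤ (elements-unique (window j e s))
      (λ p c → p ∈ₛ window j e s × toℕ (column p) % suc q ≡ toℕ c)
      (λ {p} p∈ → fromℕ< (m%n<n (toℕ (column p)) (suc q)) , ∈-elements⁻ (window j e s) p∈ , sym (Fin.toℕ-fromℕ< _))
      determined
      where
      determined : ∀ {p r} {c : Fin (suc q)} → p ∈ₛ window j e s × toℕ (column p) % suc q ≡ toℕ c →
                   r ∈ₛ window j e s × toℕ (column r) % suc q ≡ toℕ c → p ≡ r
      determined {p} {r} (p∈ , pc) (r∈ , rc) =
        let (p∈B , p∈j) = Sub.x∈p∩q⁻ (houghPattern n e s) (block j) p∈
            (r∈B , r∈j) = Sub.x∈p∩q⁻ (houghPattern n e s) (block j) r∈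
            same-column = Fin.toℕ-injective (trans (∈-block-column {j} p∈j)
              (trans (cong (λ c → toℕ j * suc q + c) (trans pc (sym rc))) (sym (∈-block-column {j} r∈j))))
            same-row = trans (∈-houghPattern⁻ p∈B) (trans (cong (line e s) same-column) (sym (∈-houghPattern⁻ r∈B)))
        in trans (sym (Fin.combine-remQuot {n} n p))
             (trans (cong₂ combine same-column same-row) (Fin.combine-remQuot {n} n r))

    -- The last block may overhang the image. The rises there are still read off `height`, so every
    -- block has exactly q bits.
    rises : Fin (suc lastBlock) → Fin n → Fin (2 ^ q)
    rises j e = funToFin {q} (λ i → rise e (toℕ j * suc q + toℕ i))

    rises-determine : ∀ {j e e′} → rises j e ≡ rises j e′ →
                      ∀ (i : Fin q) → rise e (toℕ j * suc q + toℕ i) ≡ rise e′ (toℕ j * suc q + toℕ i)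
    rises-determine eq i = trans (sym (Fin.finToFun-funToFin _ i))
      (trans (cong (λ f → finToFun {2} {q} f i) eq) (Fin.finToFun-funToFin _ i))

    start : Fin (suc lastBlock) → Fin n → Fin n → Fin n
    start j e s = fromℕ< (m%n<n (height (toℕ e) (toℕ j * suc q) + toℕ s) n)

    code : Fin (suc lastBlock) → Fin n → Fin n → Fin (suc lastBlock * (n * 2 ^ q))
    code j e s = combine j (combine (start j e s) (rises j e))

    window-⊆ : ∀ j e s e′ s′ →
      (∀ i → i ≤ q → lineHeight e s (toℕ j * suc q + i) ≡ lineHeight e′ s′ (toℕ j * suc q + i)) →
      window j e s ⊆ₛ window j e′ s′
    window-⊆ j e s e′ s′ same {p} p∈ =
      let (p∈B , p∈j) = Sub.x∈p∩q⁻ (houghPattern n e s) (block j) p∈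
          x = toℕ (column p)
      in Sub.x∈p∩q⁺ (∈-houghPattern⁺ (trans (∈-houghPattern⁻ p∈B) (Fin.toℕ-injective (begin
        toℕ (line e s (column p))                         ≡⟨ toℕ-line e s (column p) ⟩
        lineHeight e s x                                  ≡⟨ cong (lineHeight e s) (∈-block-column {j} p∈j) ⟩
        lineHeight e s (toℕ j * suc q + x % suc q)        ≡⟨ same (x % suc q) (m%n≤n-1 x) ⟩
        lineHeight e′ s′ (toℕ j * suc q + x % suc q)      ≡⟨ cong (lineHeight e′ s′) (∈-block-column {j} p∈j) ⟨
        lineHeight e′ s′ x                                ≡⟨ toℕ-line e′ s′ (column p) ⟨
        toℕ (line e′ s′ (column p))                       ∎))) , p∈j)
      where
      open ≡-Reasoning
      m%n≤n-1 : ∀ x → x % suc q ≤ q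
      m%n≤n-1 x = s≤s⁻¹ (m%n<n x (suc q))

    -- Equal codes mean the same block, the same row in its first column and the same rises, so the
    -- two lines agree at all q + 1 offsets in the block, whatever they do elsewhere.
    code-determines-window : ∀ {j e s j′ e′ s′} → code j e s ≡ code j′ e′ s′ → window j e s ≡ window j′ e′ s′
    code-determines-window {j} {e} {s} {j′} {e′} {s′} eq
      with Fin.combine-injective j (combine (start j e s) (rises j e)) j′ _ eq
    ... | refl , eq′ with Fin.combine-injective (start j e s) (rises j e) (start j e′ s′) (rises j e′) eq′
    ...   | start≡ , rises≡ = Sub.⊆-antisym
      (window-⊆ j e s e′ s′ same) (window-⊆ j e′ s′ e s (λ i i≤q → sym (same i i≤q)))
      where
      same : ∀ i → i ≤ q → lineHeight e s (toℕ j * suc q + i) ≡ lineHeight e′ s′ (toℕ j * suc q + i)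
      same = lineHeight-determined e s e′ s′ (toℕ j * suc q) q
        (trans (sym (Fin.toℕ-fromℕ< _)) (trans (cong toℕ start≡) (Fin.toℕ-fromℕ< _)))
        (rises-determine {j} {e} {e′} rises≡)

    -- Indexed by patterns rather than by pairs (e, s), so that every piece `B ∩ block j` of a
    -- pattern is a member as it stands.
    windowList : List (Subset (n * n))
    windowList = cartesianProductWith (λ B j → B ∩ block j) (patterns (houghEnsemble n)) (allFin (suc lastBlock))

    ∈-windowList⁻ : ∀ {W} → W ∈ windowList →
                    ∃[ B ] ∃[ j ] B ∈ patterns (houghEnsemble n) × W ≡ B ∩ block j
    ∈-windowList⁻ W∈
      with ∈-cartesianProductWith⁻ (λ B j → B ∩ block j) (patterns (houghEnsemble n)) (allFin (suc lastBlock)) W∈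
    ... | B , j , B∈ , _ , eq = B , j , B∈ , eq

    ∈-windowList⇒window : ∀ {W} → W ∈ windowList → ∃[ j ] ∃[ e ] ∃[ s ] W ≡ window j e s
    ∈-windowList⇒window W∈ with ∈-windowList⁻ W∈
    ... | B , j , B∈ , refl with ∈-houghEnsemble⁻ B∈
    ...   | e , s , refl = j , e , s , refl

    ∈-windows : ∀ {B} → B ∈ patterns (houghEnsemble n) → ∀ j → B ∩ block j ∈ deduplicate _≟ₛ_ windowList
    ∈-windows B∈ j = ∈-deduplicate⁺ _≟ₛ_ (∈-cartesianProductWith⁺ (λ B j → B ∩ block j) B∈ (∈-allFin j))

    windows : Ensemble (n * n)
    windows = record
      { patterns        = deduplicate _≟ₛ_ windowList
      ; unique          = Unique.deduplicate-! _≟ₛ_ windowList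
      ; nonempty        = λ eq → ¬Any[] (subst (proj₁ somePattern ∩ block zero ∈_) eq (∈-windows (proj₂ somePattern) zero))
      ; patternNonempty = All.tabulate λ W∈ → window-is-nonempty (∈-deduplicate⁻ _≟ₛ_ windowList W∈)
      }
      where
      somePattern : ∃[ B ] B ∈ patterns (houghEnsemble n)
      somePattern with patterns (houghEnsemble n) | nonempty (houghEnsemble n)
      ... | []    | ne = contradiction refl ne
      ... | B ∷ _ | _  = B , here refl
      window-is-nonempty : ∀ {W} → W ∈ windowList → Nonempty W
      window-is-nonempty W∈ with ∈-windowList⇒window W∈
      ... | j , e , s , refl = window-nonempty j e s

    windows-size : length (patterns windows) ≤ suc lastBlock * (n * 2 ^ q)
    windows-size = unique⇒length≤ (unique windows)
      -- A window may lie on several lines, and in an overhanging last block these may give it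
      -- different codes.
      (λ W c → ∃[ j ] ∃[ e ] ∃[ s ] W ≡ window j e s × c ≡ code j e s)
      (λ W∈ → let (j , e , s , eq) = ∈-windowList⇒window (∈-deduplicate⁻ _≟ₛ_ windowList W∈) in
        code j e s , j , e , s , eq , refl)
      (λ { (j , e , s , refl , refl) (j′ , e′ , s′ , refl , eq) → code-determines-window {j} {e} {s} {j′} {e′} {s′} eq })

    pattern-decomposition : ∀ {B} → B ∈ patterns (houghEnsemble n) →
      ∃[ σ ] σ ⊆ patterns windows × σ PartitionOf B × length σ ≤ suc lastBlock
    pattern-decomposition {B} B∈ = pieces-partition windows (λ j → B ∩ block j) (∈-windows B∈)
      (λ {i} {j} → block-disjoint {i} {j} {B})
      (λ {p} p∈ → blockOf p , Sub.x∈p∩q⁺ (p∈ , ∈-blockOf p))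
      (λ j → Sub.p∩q⊆p B (block j))

    windows▷houghEnsemble : windows ▷ houghEnsemble n
    windows▷houghEnsemble = All.tabulate λ B∈ → let (σ , σ⊆ , part , _) = pattern-decomposition B∈ in σ , σ⊆ , part

    ω-windows-≤ : ∀ {B} → B ∈ patterns (houghEnsemble n) → ω windows B ≤ lastBlock
    ω-windows-≤ B∈ = let (σ , σ⊆ , part , len) = pattern-decomposition B∈ in ω-≤ windows σ⊆ part len

    module _ {P} (ne : Nonempty P) (patterns⊆P : ∀ {B} → B ∈ patterns (houghEnsemble n) → B ⊆ₛ P) where

      window-⊆P : ∀ {W} → W ∈ patterns windows → W ⊆ₛ P
      window-⊆P W∈ x∈W with ∈-windowList⁻ (∈-deduplicate⁻ _≟ₛ_ windowList W∈)
      ... | B , j , B∈ , refl = patterns⊆P B∈ (Sub.p∩q⊆p B (block j) x∈W)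

      ω-singletons-window-≤ : ∀ {W} → W ∈ patterns windows → ω (singletons P ne) W ≤ q
      ω-singletons-window-≤ W∈ with ∈-windowList⇒window (∈-deduplicate⁻ _≟ₛ_ windowList W∈) | window-⊆P W∈
      ... | j , e , s , refl | W⊆P = ω-singletons-≤ ne (window-nonempty j e s) W⊆P (window-size j e s)

      blockChain : Chain (singletons P ne) (houghEnsemble n)
      blockChain = _∷_ {ℬ = windows} (singletons-▷ ne windows window-⊆P) (windows▷houghEnsemble ∷ [])

      blockChain-weight : weight blockChain ≤ suc lastBlock * (n * 2 ^ q) * q + n * n * lastBlock
      blockChain-weight = ℕ.+-mono-≤
        (ℕ.≤-trans (sum-map-≤ (ω (singletons P ne)) (patterns windows) ω-singletons-window-≤)
                   (ℕ.*-monoˡ-≤ q windows-size))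
        (ℕ.≤-trans (ℕ.≤-reflexive (ℕ.+-identityʳ _))
          (ℕ.≤-trans (sum-map-≤ (ω windows) (patterns (houghEnsemble n)) ω-windows-≤)
                     (ℕ.*-monoˡ-≤ lastBlock houghEnsemble-size)))

      blockChain-depth : depth blockChain ≤ ⌈log₂ suc q ⌉ + ⌈log₂ suc lastBlock ⌉
      blockChain-depth = ℕ.+-mono-≤
        (stepDepth-≤ (singletons P ne) windows ω-singletons-window-≤)
        (ℕ.≤-trans (ℕ.≤-reflexive (ℕ.+-identityʳ _)) (stepDepth-≤ windows (houghEnsemble n) ω-windows-≤))

-- Integer inequalities for weight and depth.

-- q is ℓ/2 rounded down, presented by equations so that ℓ can be substituted away in each case.
even∨odd : ∀ ℓ → ∃[ q ] (ℓ ≡ 2 * q ⊎ ℓ ≡ suc (2 * q))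
even∨odd zero = 0 , inj₁ refl
even∨odd (suc ℓ) with even∨odd ℓ
... | q , inj₁ refl = q , inj₂ refl
... | q , inj₂ refl = suc q , inj₁ (sym (ℕ.*-suc 2 q))

suc≤2^ : ∀ q → suc q ≤ 2 ^ q
suc≤2^ zero    = s≤s z≤n
suc≤2^ (suc q) = ℕ.≤-trans (ℕ.+-mono-≤ (ℕ.m^n>0 2 q) (suc≤2^ q))
  (ℕ.≤-reflexive (cong (λ t → 2 ^ q + t) (sym (ℕ.+-identityʳ (2 ^ q)))))

2*≤2^ : ∀ q → 2 * q ≤ 2 ^ q
2*≤2^ zero    = z≤n
2*≤2^ (suc q) = ℕ.*-monoʳ-≤ 2 (suc≤2^ q)

2^2*≡ : ∀ q → 2 ^ (2 * q) ≡ 2 ^ q * 2 ^ q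
2^2*≡ q = trans (cong (λ e → 2 ^ (q + e)) (ℕ.+-identityʳ q)) (ℕ.^-distribˡ-+-* 2 q q)

-- Since 2q ≤ 2^q, the term 2q 2^q is at most t = 4^q. For even ℓ, t ≤ n gives the claim directly.
-- For odd ℓ, the sharper 2t ≤ n compensates for the larger factor 3 + 2q.
[2+ℓ]*[n+2q2^q]≤ : ∀ ℓ q {n} → ℓ ≡ 2 * q ⊎ ℓ ≡ suc (2 * q) → 2 ^ ℓ ≤ n →
                   (2 + ℓ) * (n + 2 * q * 2 ^ q) ≤ 4 * suc q * n
[2+ℓ]*[n+2q2^q]≤ ℓ q {n} (inj₁ refl) 2^ℓ≤n = begin
  (2 + 2 * q) * (n + 2 * q * 2 ^ q)    ≤⟨ ℕ.*-monoʳ-≤ (2 + 2 * q) (ℕ.+-monoʳ-≤ n (ℕ.*-monoˡ-≤ (2 ^ q) (2*≤2^ q))) ⟩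
  (2 + 2 * q) * (n + 2 ^ q * 2 ^ q)    ≤⟨ ℕ.*-monoʳ-≤ (2 + 2 * q) (ℕ.+-monoʳ-≤ n (subst (_≤ n) (2^2*≡ q) 2^ℓ≤n)) ⟩
  (2 + 2 * q) * (n + n)                ≡⟨ solve 2 (λ q n → (con 2 :+ con 2 :* q) :* (n :+ n) := con 4 :* (con 1 :+ q) :* n) refl q n ⟩
  4 * suc q * n                        ∎
  where
  open ℕ.≤-Reasoning
  open ℕ-Solver
-- For q = 0 the term 2q 2^q vanishes; replacing it by 4^q = 1 would be too coarse at n = 2.
[2+ℓ]*[n+2q2^q]≤ ℓ zero {n} (inj₂ refl) 2^ℓ≤n = begin
  3 * (n + 0)    ≡⟨ cong (3 *_) (ℕ.+-identityʳ n) ⟩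
  3 * n          ≤⟨ ℕ.*-monoˡ-≤ n {3} {4} (ℕ.n≤1+n 3) ⟩
  4 * n          ∎
  where open ℕ.≤-Reasoning
[2+ℓ]*[n+2q2^q]≤ ℓ q@(suc p) {n} (inj₂ refl) 2^ℓ≤n = begin
  (3 + 2 * q) * (n + 2 * q * 2 ^ q)               ≤⟨ ℕ.*-monoʳ-≤ (3 + 2 * q) (ℕ.+-monoʳ-≤ n (ℕ.*-monoˡ-≤ (2 ^ q) (2*≤2^ q))) ⟩
  -- With q = p + 1, the extra (2p + 1)t completes the coefficient of t to 2(3 + 2p), so that 2t ≤ n
  -- applies.
  (3 + 2 * q) * (n + t)                           ≤⟨ ℕ.m≤m+n _ ((2 * p + 1) * t) ⟩
  (3 + 2 * q) * (n + t) + (2 * p + 1) * t         ≡⟨ solve 3 (λ p n t → (con 3 :+ con 2 :* (con 1 :+ p)) :* (n :+ t) :+ (con 2 :* p :+ con 1) :* t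
                                                                  := (con 3 :+ con 2 :* (con 1 :+ p)) :* n :+ (con 3 :+ con 2 :* p) :* (con 2 :* t)) refl p n t ⟩
  (3 + 2 * q) * n + (3 + 2 * p) * (2 * t)         ≤⟨ ℕ.+-monoʳ-≤ ((3 + 2 * q) * n) (ℕ.*-monoʳ-≤ (3 + 2 * p) (subst (λ t → 2 * t ≤ n) (2^2*≡ q) 2^ℓ≤n)) ⟩
  (3 + 2 * q) * n + (3 + 2 * p) * n               ≡⟨ solve 2 (λ p n → (con 3 :+ con 2 :* (con 1 :+ p)) :* n :+ (con 3 :+ con 2 :* p) :* n
                                                                  := con 4 :* (con 2 :+ p) :* n) refl p n ⟩
  4 * suc q * n                                   ∎
  where
  open ℕ.≤-Reasoning
  open ℕ-Solver
  t = 2 ^ q * 2 ^ q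

-- After multiplication by q + 1, the first occurrence of k needs only k(q + 1) + (q + 1) ≤ 2n.
-- Adding n²(2 + ℓ) to both sides turns the second into k(q + 1) + 1 ≤ n, and the same summand on
-- the right makes the inequality strict.
weight-bound : ∀ ℓ q {n k} .{{_ : NonZero n}} → ℓ ≡ 2 * q ⊎ ℓ ≡ suc (2 * q) → 2 ^ ℓ ≤ n → k * suc q < n →
               (suc k * (n * 2 ^ q) * q + n * n * k) * (2 + ℓ) < 4 * n ^ 3
weight-bound ℓ q {n} {k} par 2^ℓ≤n k< = ℕ.*-cancelˡ-< (suc q) _ _ (ℕ.+-cancelʳ-< (n * n * (2 + ℓ)) _ _ (begin-strict
  suc q * ((suc k * (n * t) * q + n * n * k) * (2 + ℓ)) + n * n * (2 + ℓ)
    ≡⟨ solve 5 (λ q k n t l → (con 1 :+ q) :* (((con 1 :+ k) :* (n :* t) :* q :+ n :* n :* k) :* (con 2 :+ l)) :+ n :* n :* (con 2 :+ l)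
         := ((k :* (con 1 :+ q) :+ (con 1 :+ q)) :* (n :* t :* q) :+ n :* n :* (con 1 :+ k :* (con 1 :+ q))) :* (con 2 :+ l)) refl q k n t ℓ ⟩
  ((k * suc q + suc q) * (n * t * q) + n * n * suc (k * suc q)) * (2 + ℓ)
    ≤⟨ ℕ.*-monoˡ-≤ (2 + ℓ) (ℕ.+-mono-≤ (ℕ.*-monoˡ-≤ (n * t * q) k+1≤) (ℕ.*-monoʳ-≤ (n * n) k<)) ⟩
  ((n + n) * (n * t * q) + n * n * n) * (2 + ℓ)
    ≡⟨ solve 4 (λ q n t l → ((n :+ n) :* (n :* t :* q) :+ n :* n :* n) :* (con 2 :+ l)
         := n :* n :* ((con 2 :+ l) :* (n :+ con 2 :* q :* t))) refl q n t ℓ ⟩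
  n * n * ((2 + ℓ) * (n + 2 * q * t))
    ≤⟨ ℕ.*-monoʳ-≤ (n * n) ([2+ℓ]*[n+2q2^q]≤ ℓ q par 2^ℓ≤n) ⟩
  n * n * (4 * suc q * n)
    <⟨ ℕ.m<m+n _ (>-nonZero⁻¹ (n * n * (2 + ℓ)) {{ℕ.m*n≢0 (n * n) (2 + ℓ) {{ℕ.m*n≢0 n n}}}}) ⟩
  n * n * (4 * suc q * n) + n * n * (2 + ℓ)
    ≡⟨ cong (_+ n * n * (2 + ℓ)) (solve 2 (λ q n → n :* n :* (con 4 :* (con 1 :+ q) :* n) := (con 1 :+ q) :* (con 4 :* (n :* (n :* (n :* con 1))))) refl q n) ⟩
  suc q * (4 * n ^ 3) + n * n * (2 + ℓ) ∎))
  where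
  open ℕ.≤-Reasoning
  open ℕ-Solver
  t = 2 ^ q
  q≤ℓ : ∀ {ℓ} → ℓ ≡ 2 * q ⊎ ℓ ≡ suc (2 * q) → q ≤ ℓ
  q≤ℓ (inj₁ refl) = ℕ.m≤m+n q _
  q≤ℓ (inj₂ refl) = ℕ.≤-trans (ℕ.m≤m+n q _) (ℕ.n≤1+n _)
  k+1≤ : k * suc q + suc q ≤ n + n
  k+1≤ = begin
    k * suc q + suc q      ≡⟨ ℕ.+-suc (k * suc q) q ⟩
    -- Rounding up the number of blocks costs q, and q ≤ ℓ < 2^ℓ ≤ n.
    suc (k * suc q) + q    ≤⟨ ℕ.+-mono-≤ k< (ℕ.≤-trans (q≤ℓ par) (ℕ.≤-trans (ℕ.<⇒≤ (suc≤2^ ℓ)) 2^ℓ≤n)) ⟩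
    n + n                  ∎

-- With ℓ ≥ 1, halving gives q ≤ ℓ - 1, and (ℓ - 1) + (ℓ + 1) ≤ (ℓ - 1)(ℓ + 1) + (ℓ + 1).
depth-bound : ∀ ℓ q → ℓ ≡ 2 * q ⊎ ℓ ≡ suc (2 * q) → 1 ≤ ℓ → q + suc ℓ ≤ ℓ * suc ℓ
depth-bound (suc m) q par _ = begin
  q + suc (suc m)                        ≤⟨ ℕ.+-monoˡ-≤ (suc (suc m)) (q≤m q par) ⟩
  m + suc (suc m)                        ≤⟨ ℕ.+-monoˡ-≤ (suc (suc m)) (ℕ.m≤m*n m (suc (suc m))) ⟩
  m * suc (suc m) + suc (suc m)          ≡⟨ ℕ.+-comm (m * suc (suc m)) _ ⟩
  suc m * suc (suc m)                    ∎
  where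
  open ℕ.≤-Reasoning
  q≤m : ∀ q → suc m ≡ 2 * q ⊎ suc m ≡ suc (2 * q) → q ≤ m
  q≤m q       (inj₂ eq) = ℕ.≤-trans (ℕ.m≤m+n q _) (ℕ.≤-reflexive (sym (ℕ.suc-injective eq)))
  q≤m (suc q) (inj₁ eq) = ℕ.≤-trans (ℕ.m≤n+m (suc q) q)
    (ℕ.≤-reflexive (trans (cong (λ r → q + suc r) (sym (ℕ.+-identityʳ q))) (sym (ℕ.suc-injective eq))))

-- Rational estimates of the logarithm and passage to the reals.

log₂-numerator-≥ : ∀ n .{{_ : NonZero n}} k → ⌊log₂ n ⌋ * suc k ≤ ⌊log₂ n ^ suc k ⌋
log₂-numerator-≥ n k = subst (_≤ ⌊log₂ n ^ suc k ⌋) (⌊log₂[2^n]⌋≡n (⌊log₂ n ⌋ * suc k))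
  (⌊log₂⌋-mono-≤ (ℕ.≤-trans (ℕ.≤-reflexive (sym (ℕ.^-*-assoc 2 ⌊log₂ n ⌋ (suc k))))
    (ℕ.^-monoˡ-≤ (suc k) (2^⌊log₂⌋≤ n (≢-nonZero (≢-nonZero⁻¹ n))))))

-- Comparison with the approximation of index 0, whose numerator is `⌊log₂ n ⌋` because n ^ 1 = n.
log₂-numerator-≤ : ∀ n .{{_ : NonZero n}} k → ⌊log₂ n ^ suc k ⌋ ≤ suc ⌊log₂ n ⌋ * suc k
log₂-numerator-≤ n k = subst (λ m → ⌊log₂ n ^ suc k ⌋ ≤ suc ⌊log₂ m ⌋ * suc k) (ℕ.^-identityʳ n)
  (ℕ.≤-trans (ℕ.≤-reflexive (sym (ℕ.*-identityʳ _))) (log-close n k 0))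

/-≤ : ∀ a b d e → a * suc e ≤ b * suc d → + a ℚ./ suc d ℚ.≤ + b ℚ./ suc e
/-≤ a b d e le = ℚ.*≤* (subst₂ ℤ._≤_ (ℤ.pos-* a (suc e)) (ℤ.pos-* b (suc d)) (ℤ.+≤+ le))

log₂-≥ : ∀ n .{{_ : NonZero n}} k → + ⌊log₂ n ⌋ ℚ./ 1 ℚ.≤ approx (log₂ n) k
log₂-≥ n k = /-≤ _ _ 0 k (ℕ.≤-trans (log₂-numerator-≥ n k) (ℕ.≤-reflexive (sym (ℕ.*-identityʳ _))))

log₂-≤ : ∀ n .{{_ : NonZero n}} k → approx (log₂ n) k ℚ.≤ + suc ⌊log₂ n ⌋ ℚ./ 1
log₂-≤ n k = /-≤ _ _ k 0 (ℕ.≤-trans (ℕ.≤-reflexive (ℕ.*-identityʳ _)) (log₂-numerator-≤ n k))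

-- The right-hand side has the shape to which one approximation of the real bound unfolds, with l
-- for the logarithm and s for the square root, which is dropped as non-negative.
rhs-≥ : ∀ {C l D s} → 0ℚᵘ ℚ.≤ C → 0ℚᵘ ℚ.< l → l ℚ.+ 1ℚᵘ ℚ.≤ D → 0ℚᵘ ℚ.≤ s →
        C ℚ.* inv D ℚ.≤ C ℚ.* inv l ℚ.* (1ℚᵘ ℚ.+ ℚ.- (1ℚᵘ ℚ.* inv (l ℚ.+ 1ℚᵘ)) ℚ.+ s)
rhs-≥ {C} {l} {D} {s} C≥0 l>0 l+1≤D s≥0 = begin
  C ℚ.* inv D                                                  ≤⟨ ℚ.*-monoʳ-≤-nonNeg C {{ℚ.nonNegative C≥0}} (inv-antimono l+1>0 l+1≤D) ⟩
  C ℚ.* i                                                      ≃⟨ ℚ.*-identityʳ (C ℚ.* i) ⟨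
  C ℚ.* i ℚ.* 1ℚᵘ                                              ≃⟨ ℚ.*-congˡ {C ℚ.* i} (inv-inverse l>0) ⟨
  -- The factor l i is rewritten as (l + 1) i - i, and (l + 1) i then collapses to 1.
  C ℚ.* i ℚ.* (l ℚ.* inv l)                                    ≃⟨ solve 4 (λ C i l j → C :* i :* (l :* j) := C :* j :* ((l :+ con 1ℚᵘ) :* i :+ :- (con 1ℚᵘ :* i) :+ con 0ℚᵘ)) ℚ.≃-refl C i l (inv l) ⟩
  C ℚ.* inv l ℚ.* ((l ℚ.+ 1ℚᵘ) ℚ.* i ℚ.+ ℚ.- (1ℚᵘ ℚ.* i) ℚ.+ 0ℚᵘ)  ≃⟨ ℚ.*-congˡ {C ℚ.* inv l} (ℚ.+-congˡ 0ℚᵘ (ℚ.+-congˡ (ℚ.- (1ℚᵘ ℚ.* i)) (inv-inverse l+1>0))) ⟩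
  C ℚ.* inv l ℚ.* (1ℚᵘ ℚ.+ ℚ.- (1ℚᵘ ℚ.* i) ℚ.+ 0ℚᵘ)            ≤⟨ ℚ.*-monoʳ-≤-nonNeg (C ℚ.* inv l) {{C/l≥0}} (ℚ.+-monoʳ-≤ (1ℚᵘ ℚ.+ ℚ.- (1ℚᵘ ℚ.* i)) s≥0) ⟩
  C ℚ.* inv l ℚ.* (1ℚᵘ ℚ.+ ℚ.- (1ℚᵘ ℚ.* i) ℚ.+ s)              ∎
  where
  open ℚ.≤-Reasoning
  open ℚ-Solver
  i = inv (l ℚ.+ 1ℚᵘ)
  l+1>0 : 0ℚᵘ ℚ.< l ℚ.+ 1ℚᵘ
  l+1>0 = ℚ.<-≤-trans l>0 (ℚ.p≤p+q l 1ℚᵘ)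
  C/l≥0 : ℚ.NonNegative (C ℚ.* inv l)
  C/l≥0 = ℚ.nonNeg*nonNeg⇒nonNeg C {{ℚ.nonNegative C≥0}} (inv l) {{ℚ.nonNegative (ℚ.<⇒≤ (inv-pos l>0))}}

quotient-> : ∀ {w c} d → w * suc d < c → + w ℚ./ 1 ℚ.< + c ℚ./ 1 ℚ.* inv (+ suc d ℚ./ 1)
quotient-> {w} {c} d lt = ℚ.*<* (subst₂ ℤ._<_
  (trans (ℤ.pos-* w (suc d)) (cong (λ e → + w ℤ.* + suc e) (sym (ℕ.+-identityʳ d))))
  (sym (trans (ℤ.*-identityʳ (+ c ℤ.* + 1)) (ℤ.*-identityʳ (+ c))))
  (ℤ.+<+ lt))

-- The strict order on reals asks for one gap valid at all late indices; a separating rational q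
-- provides q - w at every index.
fromℕ-<ᴿ : ∀ {w x} q → + w ℚ./ 1 ℚ.< q → (∀ k → q ℚ.≤ approx x k) → fromℕ w <ᴿ x
fromℕ-<ᴿ {w} {x} q w<q q≤x = q ℚ.- p ,
  ℚ.<-respˡ-≃ (ℚ.+-inverseʳ p) (ℚ.+-monoˡ-< (ℚ.- p) w<q) , 0 ,
  λ k _ → ℚ.≤-trans (ℚ.≤-reflexive (solve 2 (λ p q → p :+ (q :- p) := q) ℚ.≃-refl p q)) (q≤x k)
  where
  open ℚ-Solver
  p = + w ℚ./ 1

pointwise-≤ᴿ : ∀ {x y} → (∀ k → approx x k ℚ.≤ approx y k) → x ≤ᴿ y
pointwise-≤ᴿ {x} {y} x≤y ε ε>0 = 0 , λ k _ →
  ℚ.≤-trans (x≤y k) (ℚ.p≤p+q (approx y k) ε {{ℚ.nonNegative (ℚ.<⇒≤ ε>0)}})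

/1-suc : ∀ m → + m ℚ./ 1 ℚ.+ 1ℚᵘ ℚ.≃ + suc m ℚ./ 1
/1-suc m = ℚ.*≡* (solve 1 (λ m → (m :* con (+ 1) :+ con (+ 1) :* con (+ 1)) :* con (+ 1) := (con (+ 1) :+ m) :* con (+ 1)) refl (+ m))
  where open ℤ-Solver

/1-* : ∀ m k → + m ℚ./ 1 ℚ.* (+ k ℚ./ 1) ℚ.≃ + (m * k) ℚ./ 1
/1-* m k = ℚ.*≡* (cong (ℤ._* + 1) (sym (ℤ.pos-* m k)))

-- The chain and its bounds in terms of log₂ n.

module _ (n : ℕ) .{{_ : NonTrivial n}} where

  private
    instance
      n≢0 : NonZero n
      n≢0 = nonTrivial⇒nonZero n

    ℓ = ⌊log₂ n ⌋

  1≤⌊log₂⌋ : 1 ≤ ℓ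
  1≤⌊log₂⌋ = ⌊log₂⌋-mono-≤ {2} {n} (nonTrivial⇒n>1 n)

  bound : ℝ
  bound = fromℕ (4 * n ^ 3) /ᴿ log₂ n *ᴿ (fromℕ 1 -ᴿ fromℕ 1 /ᴿ (log₂ n +ᴿ fromℕ 1) +ᴿ √[ 2 / n ])

  -- The separating rational is 4n³/(ℓ + 2), as every approximation of log₂ n + 1 is at most ℓ + 2.
  <bound : ∀ {w} → w * (2 + ℓ) < 4 * n ^ 3 → fromℕ w <ᴿ bound
  <bound {w} lt = fromℕ-<ᴿ {w} {bound} (+ (4 * n ^ 3) ℚ./ 1 ℚ.* inv (+ suc (suc ℓ) ℚ./ 1)) (quotient-> (suc ℓ) lt)
    λ k → rhs-≥ {+ (4 * n ^ 3) ℚ./ 1} {approx (log₂ n) k} {+ suc (suc ℓ) ℚ./ 1} {approx √[ 2 / n ] k}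
      (/-≤ 0 (4 * n ^ 3) 0 0 z≤n)
      (ℚ.<-≤-trans (ℚ.positive⁻¹ 1ℚᵘ) (ℚ.≤-trans (/-≤ 1 ℓ 0 0 (ℕ.*-monoˡ-≤ 1 1≤⌊log₂⌋)) (log₂-≥ n k)))
      (ℚ.≤-trans (ℚ.+-monoˡ-≤ 1ℚᵘ (log₂-≤ n k)) (ℚ.≤-reflexive (/1-suc (suc ℓ))))
      (/-≤ 0 (sqrtNumerator 2 n k) 0 k z≤n)

  ≤log₂*[log₂+1] : ∀ {m} → m ≤ ℓ * suc ℓ → fromℕ m ≤ᴿ log₂ n *ᴿ (log₂ n +ᴿ fromℕ 1)
  ≤log₂*[log₂+1] {m} m≤ = pointwise-≤ᴿ {fromℕ m} {log₂ n *ᴿ (log₂ n +ᴿ fromℕ 1)} λ k → let l = approx (log₂ n) k in begin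
    + m ℚ./ 1                              ≤⟨ /-≤ m (ℓ * suc ℓ) 0 0 (ℕ.*-monoˡ-≤ 1 m≤) ⟩
    + (ℓ * suc ℓ) ℚ./ 1                    ≃⟨ /1-* ℓ (suc ℓ) ⟨
    + ℓ ℚ./ 1 ℚ.* (+ suc ℓ ℚ./ 1)          ≃⟨ ℚ.*-congˡ {+ ℓ ℚ./ 1} (/1-suc ℓ) ⟨
    + ℓ ℚ./ 1 ℚ.* (+ ℓ ℚ./ 1 ℚ.+ 1ℚᵘ)      ≤⟨ ℚ.*-mono-≤-nonNeg {{ℚ.nonNegative (/-≤ 0 ℓ 0 0 z≤n)}} {{ℚ.nonNegative (ℚ.≤-trans (/-≤ 0 (suc ℓ) 0 0 z≤n) (ℚ.≤-reflexive (ℚ.≃-sym (/1-suc ℓ))))}}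
                                                (log₂-≥ n k) (ℚ.+-monoˡ-≤ 1ℚᵘ (log₂-≥ n k)) ⟩
    l ℚ.* (l ℚ.+ 1ℚᵘ)                      ∎
    where open ℚ.≤-Reasoning

  -- Stated for any P containing all lines, since it is applied both to the support of the ensemble
  -- and to the full image.
  smallChain : ∀ {P} (ne : Nonempty P) → (∀ {B} → B ∈ patterns (houghEnsemble n) → B ⊆ₛ P) →
               Σ[ ℭ ∈ Chain (singletons P ne) (houghEnsemble n) ]
                 weight ℭ * (2 + ℓ) < 4 * n ^ 3 × depth ℭ ≤ ℓ * suc ℓ
  smallChain ne patterns⊆P with even∨odd ℓ
  ... | q , par = blockChain ne patterns⊆P ,
    ℕ.≤-<-trans (ℕ.*-monoˡ-≤ (2 + ℓ) (blockChain-weight ne patterns⊆P))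
                (weight-bound ℓ q {n} {lastBlock} par 2^ℓ≤n lastBlock*w<n) ,
    ℕ.≤-trans (blockChain-depth ne patterns⊆P)
      -- The two layers have depth at most q, as q + 1 ≤ 2^q, and ℓ + 1, as there are at most n <
      -- 2^(ℓ + 1) blocks.
      (ℕ.≤-trans (ℕ.+-mono-≤ (⌈log₂⌉≤ (suc≤2^ q)) (⌈log₂⌉≤ (ℕ.<⇒≤ (ℕ.≤-<-trans blocks≤n (<2^1+⌊log₂⌋ n)))))
                 (depth-bound ℓ q par 1≤⌊log₂⌋))
    where
    open Windows n q
    2^ℓ≤n : 2 ^ ℓ ≤ n
    2^ℓ≤n = 2^⌊log₂⌋≤ n (≢-nonZero (≢-nonZero⁻¹ n))
    n-1<n : n ∸ 1 < n
    n-1<n = ℕ.≤-reflexive (ℕ.suc-pred n)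
    lastBlock*w<n : lastBlock * suc q < n
    lastBlock*w<n = ℕ.≤-<-trans (m/n*n≤m (n ∸ 1) (suc q)) n-1<n
    blocks≤n : suc lastBlock ≤ n
    blocks≤n = ℕ.≤-<-trans (m/n≤m (n ∸ 1) (suc q)) n-1<n
    ⌈log₂⌉≤ : ∀ {m e} → m ≤ 2 ^ e → ⌈log₂ m ⌉ ≤ e
    ⌈log₂⌉≤ {m} {e} m≤ = subst (⌈log₂ m ⌉ ≤_) (⌈log₂2^n⌉≡n e) (⌈log₂⌉-mono-≤ m≤)

corollary5p10 :
    (n : ℕ) .{{_ : NonTrivial n}} →
    let instance n≢0 = nonTrivial⇒nonZero n
        rhs = fromℕ (4 * n ^ 3) /ᴿ log₂ n *ᴿ (fromℕ 1 -ᴿ fromℕ 1 /ᴿ (log₂ n +ᴿ fromℕ 1) +ᴿ √[ 2 / n ])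
    in (fromℕ (μ (houghEnsemble n)) <ᴿ rhs)
       × (Σ[ ℭ ∈ Chain (pixels n) (houghEnsemble n) ]
            (fromℕ (weight ℭ) <ᴿ rhs)
            × (fromℕ (depth ℭ) ≤ᴿ log₂ n *ᴿ (log₂ n +ᴿ fromℕ 1)))
corollary5p10 n =
  -- This repeats the witness of non-emptiness in `pixels`, so that the second chain starts at
  -- `pixels n` on the nose.
  let origin                   = fromℕ< (>-nonZero⁻¹ n {{nonTrivial⇒nonZero n}})
      (ℭ , weight< , _)        = smallChain n (supp-nonempty (houghEnsemble n)) (λ B∈ x∈B → ∈-⋃⁺ B∈ x∈B)
      (ℭ′ , weight<′ , depth≤) = smallChain n (combine origin origin , Sub.∈⊤) (λ _ _ → Sub.∈⊤)
      μ≤weight                 = proj₂ (minimal (houghEnsemble n)) ℭ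
  in <bound n (ℕ.≤-<-trans (ℕ.*-monoˡ-≤ (2 + ⌊log₂ n ⌋) μ≤weight) weight<) ,
     ℭ′ , <bound n weight<′ , ≤log₂*[log₂+1] n depth≤
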